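{- Let $G$ be a graph of order $n \geq 2$ and $\overline{G}$ its complement. Then \[1 \leq \mathrm{pt}_+(G) + \mathrm{pt}_+(\overline{G}) \leq \frac{n}{2} + 2.\] Moreover, for every $n\ge 2$ there is a graph $G$ of order $n$ with $\mathrm{pt}_+(G) + \mathrm{pt}_+(\overline{G})=1$, and for every even $n\ge 8$ there is a graph $G$ of order $n$ with $\mathrm{pt}_+(G) + \mathrm{pt}_+(\overline{G})=\frac n2+2$.
   Context: Graphs are finite and simple; $\overline{G}$ has vertex set $V(G)$ and edges exactly the pairs of distinct non-adjacent vertices of $G$. PSD color change rule: let $B$ be the current set of blue vertices and let $W_1,\dots,W_r$ be the vertex sets of the components of $G-B$; if $u\in B$, $w\in W_i$, and $w$ is the only white neighbor of $u$ in $G[W_i\cup B]$, then $w$ may be colored blue. $B$ is a PSD forcing set if repeated application from exactly $B$ blue colors all vertices; $\mathrm{Z}_+(G)$ is the minimum size of a PSD forcing set. $B^{[0]}=B$, $B^{[i+1]}$ is $B^{[i]}$ together with all vertices that can be PSD forced when exactly $B^{[i]}$ is blue, $\mathrm{pt}_+(G;B)$ is the least $t$ with $B^{[t]}=V(G)$, and $\mathrm{pt}_+(G)=\min\{\mathrm{pt}_+(G;B):|B|=\mathrm{Z}_+(G)\}$. -}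

module Defs where

open import Data.Nat using (ℕ; zero; suc; _≤_)
open import Data.Bool using (Bool; true; false; not; if_then_else_)
open import Data.Fin using (Fin)
open import Data.Fin.Properties using (_≟_)
open import Data.Fin.Subset using (Subset; _∈_; ∣_∣)
open import Data.Product using (Σ; ∃; _×_; _,_)
open import Data.Sum using (_⊎_)
open import Relation.Nullary using (¬_; does)
open import Relation.Binary.PropositionalEquality using (_≡_)

record Graph (n : ℕ) : Set where
  field
    adj    : Fin n → Fin n → Bool
    adj-sym : ∀ i j → adj i j ≡ adj j i
    adj-irrefl : ∀ i → adj i i ≡ false
open Graph public

complement : ∀ {n} → Graph n → Graph n
complement {n} G = record { adj = a ; adj-sym = s ; adj-irrefl = ir }
  where
  a : Fin n → Fin n → Bool
  a i j = if does (i ≟ j) then false else not (adj G i j)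
  open import Relation.Binary.PropositionalEquality using (refl; sym; cong)
  open import Relation.Nullary using (yes; no)
  s : ∀ i j → a i j ≡ a j i
  s i j with i ≟ j | j ≟ i
  ... | yes _ | yes _ = refl
  ... | yes p | no q = Data.Empty.⊥-elim (q (sym p)) where import Data.Empty
  ... | no p | yes q = Data.Empty.⊥-elim (p (sym q)) where import Data.Empty
  ... | no _ | no _ = cong not (adj-sym G i j)
  ir : ∀ i → a i i ≡ false
  ir i with i ≟ i
  ... | yes _ = refl
  ... | no p = Data.Empty.⊥-elim (p refl) where import Data.Empty

VSet : ℕ → Set₁
VSet n = Fin n → Set

data Conn {n} (G : Graph n) (B : VSet n) : Fin n → Fin n → Set where
  here : ∀ {w} → ¬ B w → Conn G B w w
  step : ∀ {w y x} → ¬ B w → adj G w y ≡ true → Conn G B y x → Conn G B w x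

-- PSD color change rule: with exactly B blue, w can be forced
-- (by some blue u): w is white, w is a neighbour of u, and w is the only
-- white neighbour of u in G[W ∪ B], W the component of G - B containing w.
CanForce : ∀ {n} → Graph n → VSet n → Fin n → Set
CanForce G B w =
  ∃ λ u → B u × ¬ B w × adj G u w ≡ true ×
    (∀ x → ¬ B x → adj G u x ≡ true → Conn G B w x → x ≡ w)

Iter : ∀ {n} → Graph n → Subset n → ℕ → VSet n
Iter G B zero    v = v ∈ B
Iter G B (suc t) v = Iter G B t v ⊎ CanForce G (Iter G B t) v

AllBlue : ∀ {n} → Graph n → Subset n → ℕ → Set
AllBlue G B t = ∀ v → Iter G B t v

IsPSDForcingSet : ∀ {n} → Graph n → Subset n → Set
IsPSDForcingSet G B = ∃ λ t → AllBlue G B t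

IsZplus : ∀ {n} → Graph n → ℕ → Set
IsZplus G k =
  (∃ λ B → ∣ B ∣ ≡ k × IsPSDForcingSet G B) ×
  (∀ B → IsPSDForcingSet G B → k ≤ ∣ B ∣)

IsPTB : ∀ {n} → Graph n → Subset n → ℕ → Set
IsPTB G B t = AllBlue G B t × (∀ s → AllBlue G B s → t ≤ s)

IsPt : ∀ {n} → Graph n → ℕ → Set
IsPt G p =
  ∃ λ k → IsZplus G k ×
    (∃ λ B → ∣ B ∣ ≡ k × IsPTB G B p) ×
    (∀ B t → ∣ B ∣ ≡ k → IsPTB G B t → p ≤ t)

{-# OPTIONS --safe #-}
module Submission where

-- Upper bound.  Two inequalities are combined: 2 pt₊ ≤ n − Z₊ + 1 and Z₊(G) + Z₊(Ḡ) ≥ n − 2.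
-- For the first one, let X be the component of G − B coloured last and perform all forces b → w
-- possible in X at the first step, replacing each b by its w.  Since w is the only neighbour of b in X,
-- w forces b back at once, so X is finished one step earlier and the rest at most one step later; as X and the
-- rest each gain a vertex per step until finished, this speeds B up whenever 2 pt₊ ≥ n − Z₊ + 2.
-- For the second one, the order of colouring is an elimination order of width Z₊ of a chordal supergraph H of G.
-- As H has no induced four-cycle, its non-edges form a bramble in Ḡ, and a cover of them read off an elimination
-- order of Ḡ has at most Z₊(Ḡ) + 1 vertices and leaves a clique of H, which has at most Z₊(G) + 1.
--
-- Sharpness.  The edgeless graph has sum 1.  For even n ≥ 8 take the path 2, 3, …, n − 1 and the two adjacent
-- hubs 0 ∼ 2, 3, 5, 6 and 1 ∼ 3, 4, 6, 7; then Z₊ = 3, pt₊ = n / 2 − 1 and Z₊ = n − 5, pt₊ = 3 for the complement.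
-- The first eight vertices are handled by evaluation, the pendant path by hand.

open import Defs
open import Data.Bool using (Bool; true; false; _∨_; not; if_then_else_; T)
import Data.Bool.Properties as Bool
open import Data.Empty using (⊥; ⊥-elim)
open import Data.Fin using (Fin; zero; suc; toℕ; #_; _↑ˡ_; _↑ʳ_; fromℕ; fromℕ<; splitAt)
open import Data.Fin.Properties using (_≟_; any?; all?; ¬∀⟶∃¬; toℕ<n; toℕ-injective; toℕ-↑ˡ; toℕ-↑ʳ; toℕ-fromℕ; toℕ-fromℕ<; splitAt⁻¹-↑ˡ; splitAt⁻¹-↑ʳ; ↑ˡ-injective; ↑ʳ-injective)
import Data.Fin.Properties as Fin
open import Data.Fin.Subset using (Subset; inside; outside; _∈_; _∉_; _⊆_; _∪_; _∩_; _-_; ⁅_⁆; ∁; ⊤; ∣_∣) renaming (⊥ to ∅)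
open import Data.Fin.Subset.Properties
open import Data.List using (List; []; _∷_; length)
import Data.List.Membership.Propositional as List
open import Data.List.Relation.Unary.Any using (here; there)
open import Data.Nat using (ℕ; zero; suc; _+_; _*_; _∸_; _⊓_; _≤_; _<_; z≤n; s≤s; s≤s⁻¹; _≤?_; _<?_; _≡ᵇ_)
import Data.Nat as ℕ
open import Data.Nat.Properties hiding (_≟_)
open import Data.Nat.Tactic.RingSolver using (solve-∀)
open import Data.Product using (Σ; ∃; _×_; _,_; proj₁; proj₂)
open import Data.Sum using (_⊎_; inj₁; inj₂)
open import Data.Unit using (tt)
open import Data.Vec using (_∷_; []; tabulate; here; there; _++_)
import Data.Vec as Vec
open import Data.Vec.Properties using (lookup∘tabulate; lookup⇒[]=; []=⇒lookup)
open import Function using (_∘_; id)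
open import Relation.Binary.Definitions using (Tri; tri<; tri≈; tri>)
open import Relation.Binary.PropositionalEquality using (_≡_; _≢_; refl; sym; trans; cong; cong₂; subst; module ≡-Reasoning)
open import Relation.Nullary using (Dec; yes; no; ¬_; does)
open import Relation.Nullary.Decidable using (map′; ¬?; _×-dec_; _⊎-dec_; _→-dec_; dec-true; decidable-stable; toWitness; toWitnessFalse)
open import Relation.Unary using (Decidable)

private variable
  n n′ : ℕ

-- Finite sets

select : {P : Fin n → Set} → Decidable P → Subset n
select P? = tabulate (λ x → does (P? x))

∈-select⁺ : {P : Fin n → Set} (P? : Decidable P) {x : Fin n} → P x → x ∈ select P?
∈-select⁺ P? {x} px = lookup⇒[]= x _ (trans (lookup∘tabulate _ x) (dec-true (P? x) px))

does⇒ : {A : Set} (A? : Dec A) → does A? ≡ true → A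
does⇒ (yes a) _ = a

∈-select⁻ : {P : Fin n → Set} (P? : Decidable P) {x : Fin n} → x ∈ select P? → P x
∈-select⁻ P? {x} x∈ = does⇒ (P? x) (trans (sym (lookup∘tabulate _ x)) ([]=⇒lookup x∈))

∣p∪q∣+∣p∩q∣ : (p q : Subset n) → ∣ p ∪ q ∣ + ∣ p ∩ q ∣ ≡ ∣ p ∣ + ∣ q ∣
∣p∪q∣+∣p∩q∣ [] [] = refl
∣p∪q∣+∣p∩q∣ (outside ∷ p) (outside ∷ q) = ∣p∪q∣+∣p∩q∣ p q
∣p∪q∣+∣p∩q∣ (inside  ∷ p) (outside ∷ q) = cong suc (∣p∪q∣+∣p∩q∣ p q)
∣p∪q∣+∣p∩q∣ (outside ∷ p) (inside  ∷ q) = trans (cong suc (∣p∪q∣+∣p∩q∣ p q)) (sym (+-suc _ _))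
∣p∪q∣+∣p∩q∣ (inside  ∷ p) (inside  ∷ q) =
  cong suc (trans (+-suc _ _) (trans (cong suc (∣p∪q∣+∣p∩q∣ p q)) (sym (+-suc _ _))))

∣p∪q∣≤∣p∣+∣q∣ : (p q : Subset n) → ∣ p ∪ q ∣ ≤ ∣ p ∣ + ∣ q ∣
∣p∪q∣≤∣p∣+∣q∣ p q = ≤-trans (m≤m+n _ _) (≤-reflexive (∣p∪q∣+∣p∩q∣ p q))

disjoint⇒∣p∣+∣q∣≡∣p∪q∣ : (p q : Subset n) → (∀ {x} → x ∈ p → x ∉ q) → ∣ p ∣ + ∣ q ∣ ≡ ∣ p ∪ q ∣
disjoint⇒∣p∣+∣q∣≡∣p∪q∣ {n} p q dis =
  trans (sym (∣p∪q∣+∣p∩q∣ p q))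
        (trans (cong (∣ p ∪ q ∣ +_) (trans (cong ∣_∣ (Empty-unique none)) (∣⊥∣≡0 n))) (+-identityʳ _))
  where
  none : ¬ ∃ λ x → x ∈ p ∩ q
  none (x , x∈) = let (x∈p , x∈q) = x∈p∩q⁻ p q x∈ in dis x∈p x∈q

x∉p-x : (p : Subset n) (x : Fin n) → x ∉ p - x
x∉p-x (_ ∷ p) zero ()
x∉p-x (_ ∷ p) (suc x) (there x∈) = x∉p-x p x x∈

∣p∣≤1+∣p-x∣ : (p : Subset n) (x : Fin n) → ∣ p ∣ ≤ suc ∣ p - x ∣
∣p∣≤1+∣p-x∣ p x = ≤-trans (p⊆q⇒∣p∣≤∣q∣ {q = (p - x) ∪ ⁅ x ⁆} split)
  (≤-trans (∣p∪q∣≤∣p∣+∣q∣ (p - x) ⁅ x ⁆)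
    (≤-reflexive (trans (cong (∣ p - x ∣ +_) (∣⁅x⁆∣≡1 x)) (+-comm _ 1))))
  where
  split : p ⊆ (p - x) ∪ ⁅ x ⁆
  split {y} y∈p with y ≟ x
  ... | yes refl = x∈p∪q⁺ (inj₂ (x∈⁅x⁆ x))
  ... | no  y≢x  = x∈p∪q⁺ (inj₁ (x∈p∧x≢y⇒x∈p-y y∈p y≢x))

1+∣p∣≡∣p∪⁅x⁆∣ : (p : Subset n) {x : Fin n} → x ∉ p → suc ∣ p ∣ ≡ ∣ p ∪ ⁅ x ⁆ ∣
1+∣p∣≡∣p∪⁅x⁆∣ p {x} x∉p =
  trans (+-comm 1 _) (trans (cong (∣ p ∣ +_) (sym (∣⁅x⁆∣≡1 x)))
    (disjoint⇒∣p∣+∣q∣≡∣p∪q∣ p ⁅ x ⁆ λ y∈p y∈x → x∉p (subst (_∈ p) (x∈⁅y⁆⇒x≡y x y∈x) y∈p)))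

injectiveOn⇒∣p∣≤∣q∣ : (p : Subset n) (q : Subset n′) (f : Fin n → Fin n′) →
  (∀ {x} → x ∈ p → f x ∈ q) → (∀ {x y} → x ∈ p → y ∈ p → f x ≡ f y → x ≡ y) → ∣ p ∣ ≤ ∣ q ∣
injectiveOn⇒∣p∣≤∣q∣ [] q f into inj = z≤n
injectiveOn⇒∣p∣≤∣q∣ (outside ∷ p) q f into inj =
  injectiveOn⇒∣p∣≤∣q∣ p q (f ∘ suc) (into ∘ there)
    (λ x∈ y∈ eq → Fin.suc-injective (inj (there x∈) (there y∈) eq))
injectiveOn⇒∣p∣≤∣q∣ (inside ∷ p) q f into inj =
  ≤-trans (s≤s (injectiveOn⇒∣p∣≤∣q∣ p (q - f zero) (f ∘ suc)
      (λ x∈ → x∈p∧x≢y⇒x∈p-y (into (there x∈)) (λ eq → 0≢suc (inj here (there x∈) (sym eq))))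
      (λ x∈ y∈ eq → Fin.suc-injective (inj (there x∈) (there y∈) eq))))
    (x∈p⇒∣p-x∣<∣p∣ (into here))
  where
  0≢suc : ∀ {m} {i : Fin m} → _≢_ {A = Fin (suc m)} zero (suc i)
  0≢suc ()

full⇒∣p∣≡n : {p : Subset n} → (∀ x → x ∈ p) → ∣ p ∣ ≡ n
full⇒∣p∣≡n {n} {p} all = ≤-antisym (∣p∣≤n p)
  (≤-trans (≤-reflexive (sym (∣⊤∣≡n n))) (p⊆q⇒∣p∣≤∣q∣ {p = ⊤} (λ {x} _ → all x)))

n≤∣p∣⇒∈ : (p : Subset n) → n ≤ ∣ p ∣ → ∀ x → x ∈ p
n≤∣p∣⇒∈ p n≤ x = subst (x ∈_) (sym (∣p∣≡n⇒p≡⊤ (≤-antisym (∣p∣≤n p) n≤))) ∈⊤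

chain-mono : {P : ℕ → Subset n} → (∀ t → P t ⊆ P (suc t)) → ∀ {s t} → s ≤ t → P s ⊆ P t
chain-mono {P = P} mono {s} {t} s≤t = subst (λ z → P s ⊆ P z) (m+[n∸m]≡n s≤t) (go (t ∸ s))
  where
  go : ∀ d → P s ⊆ P (s + d)
  go zero    {x} x∈ = subst (λ z → x ∈ P z) (sym (+-identityʳ s)) x∈
  go (suc d) {x} x∈ = subst (λ z → x ∈ P z) (sym (+-suc s d)) (mono _ (go d x∈))

module Chain (P : ℕ → Subset n) where

  -- Holds for every process whose next state depends only on its present one. It is used for graph
  -- search, for the colouring, and for the colouring seen on a union of components.
  Stalls : Set
  Stalls = ∀ t → P (suc t) ⊆ P t → P (suc (suc t)) ⊆ P (suc t)

  stalled-from : Stalls → ∀ {s} → P (suc s) ⊆ P s → ∀ t → P (suc (s + t)) ⊆ P (s + t)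
  stalled-from stall {s} still zero    x∈ rewrite +-identityʳ s = still x∈
  stalled-from stall {s} still (suc t) x∈ rewrite +-suc s t = stall (s + t) (stalled-from stall still t) x∈

  stable : Stalls → ∀ {s} → P (suc s) ⊆ P s → ∀ t → P (s + t) ⊆ P s
  stable stall {s} still zero    {x} x∈ = subst (λ z → x ∈ P z) (+-identityʳ s) x∈
  stable stall {s} still (suc t) {x} x∈ =
    stable stall still t (stalled-from stall still t (subst (λ z → x ∈ P z) (+-suc s t) x∈))

-- Until it stalls, the chain gains at least one element per step, so it cannot grow for more than n
-- - |P 0| steps.
stabilises : (P : ℕ → Subset n) → (∀ t → P t ⊆ P (suc t)) → Chain.Stalls P →
  ∀ k → n ≤ k + ∣ P 0 ∣ → P (suc k) ⊆ P k
stabilises P mono stall zero    n≤ {x} _ = n≤∣p∣⇒∈ (P 0) n≤ x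
stabilises P mono stall (suc k) n≤ with P 1 ⊆? P 0
... | yes still = Chain.stalled-from P stall still (suc k)
... | no  grows = stabilises (P ∘ suc) (mono ∘ suc) (stall ∘ suc) k
  (≤-trans n≤ (≤-trans (≤-reflexive (sym (+-suc k _)))
    (+-monoʳ-≤ k (p⊂q⇒∣p∣<∣q∣ (mono 0 , new)))))
  where
  new : ∃ λ x → x ∈ P 1 × x ∉ P 0
  new with any? (λ x → x ∈? P 1 ×-dec ¬? (x ∈? P 0))
  ... | yes found = found
  ... | no  none  = ⊥-elim (grows λ {x} x∈ → decidable-stable (x ∈? P 0) (λ x∉ → none (x , x∈ , x∉)))

full-after : (P : ℕ → Subset n) → (∀ t → P t ⊆ P (suc t)) → Chain.Stalls P →
  ∀ k → n ≤ k + ∣ P 0 ∣ → ∀ {T} → (∀ x → x ∈ P T) → ∀ x → x ∈ P k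
full-after P mono stall k n≤ {T} full x =
  Chain.stable P stall (stabilises P mono stall k n≤) T (chain-mono mono (m≤n+m T k) (full x))

least : {P : ℕ → Set} → Decidable P → ∀ N → P N → ∃ λ m → P m × m ≤ N × (∀ k → P k → m ≤ k)
least P? zero    pN = 0 , pN , z≤n , λ _ _ → z≤n
least {P} P? (suc N) pN with P? 0
... | yes p0 = 0 , p0 , z≤n , λ _ _ → z≤n
... | no ¬p0 with least (P? ∘ suc) N pN
...   | m , pm , m≤N , min = suc m , pm , s≤s m≤N , λ { zero p0 → ⊥-elim (¬p0 p0) ; (suc k) pk → s≤s (min k pk) }

-- Connectivity and the colour change rule

-- The body of `CanForce` with the forcing vertex exposed, so that it can be kept fixed while the
-- blue set changes.
Forces : Graph n → VSet n → Fin n → Fin n → Set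
Forces G B u w =
  B u × ¬ B w × adj G u w ≡ true × (∀ x → ¬ B x → adj G u x ≡ true → Conn G B w x → x ≡ w)

module _ {G : Graph n} where

  adj-sym-true : ∀ {x y} → adj G x y ≡ true → adj G y x ≡ true
  adj-sym-true {x} {y} e = trans (adj-sym G y x) e

  conn-source : {B : VSet n} → ∀ {x y} → Conn G B x y → ¬ B x
  conn-source (here ¬b)     = ¬b
  conn-source (step ¬b _ _) = ¬b

  conn-target : {B : VSet n} → ∀ {x y} → Conn G B x y → ¬ B y
  conn-target (here ¬b)    = ¬b
  conn-target (step _ _ c) = conn-target c

  conn-trans : {B : VSet n} → ∀ {x y z} → Conn G B x y → Conn G B y z → Conn G B x z
  conn-trans (here _)      d = d
  conn-trans (step ¬b e c) d = step ¬b e (conn-trans c d)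

  conn-snoc : {B : VSet n} → ∀ {x y z} → Conn G B x y → adj G y z ≡ true → ¬ B z → Conn G B x z
  conn-snoc c e ¬b = conn-trans c (step (conn-target c) e (here ¬b))

  conn-sym : {B : VSet n} → ∀ {x y} → Conn G B x y → Conn G B y x
  conn-sym (here ¬b)     = here ¬b
  conn-sym (step ¬b e c) = conn-snoc (conn-sym c) (adj-sym-true e) ¬b

  conn-anti : {B C : VSet n} → (∀ {x} → C x → B x) → ∀ {x y} → Conn G B x y → Conn G C x y
  conn-anti sub (here ¬b)     = here (¬b ∘ sub)
  conn-anti sub (step ¬b e c) = step (¬b ∘ sub) e (conn-anti sub c)

  conn-invariant : {B X : VSet n} → (∀ {x y} → X x → ¬ B x → ¬ B y → adj G x y ≡ true → X y) →
    ∀ {x y} → X x → Conn G B x y → X y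
  conn-invariant closed xX (here _)      = xX
  conn-invariant closed xX (step ¬b e c) = conn-invariant closed (closed xX ¬b (conn-source c) e) c

module Reach (G : Graph n) {B : VSet n} (B? : Decidable B) (w : Fin n) where

  Grown : Subset n → VSet n
  Grown R y = y ∈ R ⊎ (¬ B y × ∃ λ r → r ∈ R × adj G r y ≡ true)

  grown? : ∀ R → Decidable (Grown R)
  grown? R y = y ∈? R ⊎-dec (¬? (B? y) ×-dec any? (λ r → r ∈? R ×-dec (adj G r y Bool.≟ true)))

  -- A blue w starts an empty search, since `Conn` relates white vertices only.
  Start : VSet n
  Start y = ¬ B w × w ≡ y

  start? : Decidable Start
  start? y = ¬? (B? w) ×-dec (w ≟ y)

  reach : ℕ → Subset n
  reach zero    = select start?
  reach (suc k) = select (grown? (reach k))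

  reach-mono : ∀ k → reach k ⊆ reach (suc k)
  reach-mono k = ∈-select⁺ (grown? (reach k)) ∘ inj₁

  reach-stalls : Chain.Stalls reach
  reach-stalls t still = subst (λ R → select (grown? R) ⊆ reach (suc t))
    (⊆-antisym (reach-mono t) still) id

  reach-sound : ∀ k {y} → y ∈ reach k → Conn G B w y
  reach-sound zero y∈ with ∈-select⁻ start? y∈
  ... | ¬b , refl = here ¬b
  reach-sound (suc k) y∈ with ∈-select⁻ (grown? (reach k)) y∈
  ... | inj₁ y∈R = reach-sound k y∈R
  ... | inj₂ (¬b , r , r∈ , e) = conn-snoc (reach-sound k r∈) e ¬b

  opaque
    component : Subset n
    component = reach n

    component-sound : ∀ {y} → y ∈ component → Conn G B w y
    component-sound = reach-sound n

    component-complete : ∀ {y} → Conn G B w y → y ∈ component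
    component-complete c = conn-invariant {X = _∈ component}
      (λ x∈ _ ¬by e → stabilises reach reach-mono reach-stalls n (m≤m+n n _)
        (∈-select⁺ (grown? component) (inj₂ (¬by , _ , x∈ , e))))
      (chain-mono {P = reach} reach-mono {t = n} z≤n (∈-select⁺ start? (conn-source c , refl))) c

conn? : (G : Graph n) {B : VSet n} → Decidable B → ∀ x y → Dec (Conn G B x y)
conn? G B? x y = map′ (component-sound) (component-complete) (y ∈? component)
  where open Reach G B? x

-- The component is an argument so that evaluation computes it only once.
canForceGiven? : (G : Graph n) {B : VSet n} → Decidable B → (w : Fin n) (C : Subset n) →
  (∀ {x} → x ∈ C → Conn G B w x) → (∀ {x} → Conn G B w x → x ∈ C) → Dec (CanForce G B w)
canForceGiven? G B? w C sound complete =
  any? λ u → B? u ×-dec ¬? (B? w) ×-dec (adj G u w Bool.≟ true) ×-dec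
    all? λ x → ¬? (B? x) →-dec (adj G u x Bool.≟ true) →-dec map′ sound complete (x ∈? C) →-dec (x ≟ w)

opaque
  canForce? : (G : Graph n) {B : VSet n} → Decidable B → Decidable (CanForce G B)
  canForce? G B? w = canForceGiven? G B? w component component-sound component-complete
    where open Reach G B? w

-- Only the white vertices of G′ need counterparts in G: they alone can obstruct a force in G′.
module Simulation {G : Graph n} {G′ : Graph n′} {B : VSet n} {B′ : VSet n′} (R : Fin n → Fin n′ → Set)
  (white : ∀ {x′} → ¬ B′ x′ → ∃ λ x → R x x′ × ¬ B x)
  (adj-≡ : ∀ {a a′ b b′} → R a a′ → R b b′ → ¬ B′ b′ → adj G a b ≡ adj G′ a′ b′) where

  conn-lift : ∀ {w w′ x′} → R w w′ → ¬ B w → Conn G′ B′ w′ x′ → ∃ λ x → R x x′ × Conn G B w x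
  conn-lift r ¬b (here _) = _ , r , here ¬b
  conn-lift r ¬b (step _ e c) with white (conn-source c)
  ... | y , ry , ¬by with conn-lift ry ¬by c
  ...   | x , rx , d = x , rx , step ¬b (trans (adj-≡ r ry (conn-source c)) e) d

  -- A white neighbour of u′ in the component of w′ lifts to one of u in the component of w, so
  -- uniqueness carries over.
  forces-sim : ∀ {u u′ w w′} → R u u′ → B′ u′ → R w w′ → ¬ B′ w′ → (∀ {x′} → R w x′ → ¬ B′ x′ → x′ ≡ w′) →
    Forces G B u w → Forces G′ B′ u′ w′
  forces-sim {u} {u′} {w} {w′} ru bu′ rw ¬bw′ func (bu , ¬bw , e , unique) =
    bu′ , ¬bw′ , trans (sym (adj-≡ ru rw ¬bw′)) e , unique′
    where
    unique′ : ∀ x′ → ¬ B′ x′ → adj G′ u′ x′ ≡ true → Conn G′ B′ w′ x′ → x′ ≡ w′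
    unique′ x′ ¬bx′ e′ c with conn-lift rw ¬bw c
    ... | x , rx , d with unique x (conn-target d) (trans (adj-≡ ru rx ¬bx′) e′) d
    ...   | refl = func rx ¬bx′

-- Enlarging the blue set removes white vertices and splits components, so a force stays available
-- until its target is blue.
forces-mono : {G : Graph n} {B C : VSet n} → (∀ {x} → B x → C x) →
  ∀ {u w} → ¬ C w → Forces G B u w → Forces G C u w
forces-mono {G = G} {B} {C} sub ¬cw f@(bu , _) =
  Simulation.forces-sim {G′ = G} {B} {C} _≡_ (λ ¬c → _ , refl , ¬c ∘ sub) (λ { refl refl _ → refl })
    refl (sub bu) refl ¬cw (λ { refl _ → refl }) f

-- The propagation process as a sequence of finite sets

module _ (G : Graph n) where

  Stepped : Subset n → VSet n
  Stepped S v = v ∈ S ⊎ CanForce G (_∈ S) v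

  stepped? : ∀ S → Decidable (Stepped S)
  stepped? S v = v ∈? S ⊎-dec canForce? G (_∈? S) v

  opaque
    next : Subset n → Subset n
    next S = select (stepped? S)

    next⁺ : ∀ {S v} → Stepped S v → v ∈ next S
    next⁺ {S} = ∈-select⁺ (stepped? S)

    next⁻ : ∀ {S v} → v ∈ next S → Stepped S v
    next⁻ {S} = ∈-select⁻ (stepped? S)

  blue : Subset n → ℕ → Subset n
  blue S zero    = S
  blue S (suc t) = next (blue S t)

  blue-mono : ∀ S t → blue S t ⊆ blue S (suc t)
  blue-mono S t = next⁺ ∘ inj₁

  blue-stalls : ∀ S → Chain.Stalls (blue S)
  blue-stalls S t still = subst (λ R → next R ⊆ next (blue S t)) (⊆-antisym (blue-mono S t) still) id

  Iter-mono : ∀ S {s t} → s ≤ t → ∀ {v} → Iter G S s v → Iter G S t v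
  Iter-mono S {zero}  {zero}  _ i = i
  Iter-mono S {s} {suc t} s≤ i with s ≤? t
  ... | yes s≤t = inj₁ (Iter-mono S s≤t i)
  ... | no  s≰t rewrite ≤-antisym s≤ (≰⇒> s≰t) = i

  -- Both inclusions are proved together, because blue vertices occur positively and white ones
  -- negatively in a force.
  blue⇒Iter : ∀ S t {v} → v ∈ blue S t → Iter G S t v
  Iter⇒blue : ∀ S t {v} → Iter G S t v → v ∈ blue S t
  blue⇒Iter S zero    v∈ = v∈
  blue⇒Iter S (suc t) v∈ with next⁻ v∈
  ... | inj₁ old = inj₁ (blue⇒Iter S t old)
  ... | inj₂ (u , f@(_ , ¬b , _)) = inj₂ (u , forces-mono (blue⇒Iter S t) (¬b ∘ Iter⇒blue S t) f)
  Iter⇒blue S zero    v∈ = v∈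
  Iter⇒blue S (suc t) (inj₁ old) = blue-mono S t (Iter⇒blue S t old)
  Iter⇒blue S (suc t) (inj₂ (u , f@(_ , ¬b , _))) =
    next⁺ (inj₂ (u , forces-mono (Iter⇒blue S t) (¬b ∘ blue⇒Iter S t) f))

  Iter? : ∀ S t → Decidable (Iter G S t)
  Iter? S t v = map′ (blue⇒Iter S t) (Iter⇒blue S t) (v ∈? blue S t)

  AllBlue? : ∀ S → Decidable (AllBlue G S)
  AllBlue? S t = all? (Iter? S t)

  AllBlue-mono : ∀ S {s t} → s ≤ t → AllBlue G S s → AllBlue G S t
  AllBlue-mono S s≤t a v = Iter-mono S s≤t (a v)

  -- The process has stalled after n steps; this bound on the time makes forcing decidable.
  AllBlue-n : ∀ S → IsPSDForcingSet G S → AllBlue G S n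
  AllBlue-n S (T , a) v = blue⇒Iter S n
    (full-after (blue S) (blue-mono S) (blue-stalls S) n (m≤m+n n _) {T} (λ x → Iter⇒blue S T (a x)) v)

  forcingSet? : Decidable (IsPSDForcingSet G)
  forcingSet? S = map′ (n ,_) (AllBlue-n S) (AllBlue? S n)

  Zplus-exists : ∃ (IsZplus G)
  Zplus-exists with least (λ k → anySubset? (λ B → (∣ B ∣ ℕ.≟ k) ×-dec forcingSet? B)) ∣ ⊤ {n} ∣
                      (⊤ , refl , 0 , λ _ → ∈⊤)
  ... | k , w , _ , min = k , w , λ B f → min ∣ B ∣ (B , refl , f)

  pt-exists : ∃ (IsPt G)
  pt-exists with Zplus-exists
  ... | k , z@((B , ∣B∣ , T , a) , _)
    with least (λ t → anySubset? (λ B → (∣ B ∣ ℕ.≟ k) ×-dec AllBlue? B t)) T (B , ∣B∣ , a)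
  ...   | p , (C , ∣C∣ , ac) , _ , min =
    p , k , z , (C , ∣C∣ , ac , λ s as → min s (C , ∣C∣ , as)) , λ D t ∣D∣ (ad , _) → min t (D , ∣D∣ , ad)

  pt≤ : ∀ {p} ((k , _) : IsPt G p) → ∀ B t → ∣ B ∣ ≡ k → AllBlue G B t → p ≤ t
  pt≤ (k , _ , _ , min) B t ∣B∣ a with least (AllBlue? B) t a
  ... | s , as , s≤t , mins = ≤-trans (min B s ∣B∣ (as , mins)) s≤t

-- The bound 2 pt₊ ≤ n − Z₊ + 1

-- The white part of X is a union of components of G - B; blue members of X are unconstrained.
ClosedOff : Graph n → VSet n → VSet n → Set
ClosedOff G B X = ∀ {x y} → X x → ¬ B x → ¬ B y → adj G x y ≡ true → X y

closedOff-compl : {G : Graph n} {B X : VSet n} → ClosedOff G B X → ClosedOff G B (¬_ ∘ X)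
closedOff-compl {G = G} cl ¬Xx ¬bx ¬by e Xy = ¬Xx (cl Xy ¬by ¬bx (adj-sym-true {G = G} e))

conn-transfer : {G : Graph n} {B C X : VSet n} → ClosedOff G B X → (∀ {x} → X x → ¬ B x → ¬ C x) →
  ∀ {x y} → X x → Conn G B x y → Conn G C x y
conn-transfer cl sub Xx (here ¬b)     = here (sub Xx ¬b)
conn-transfer cl sub Xx (step ¬b e d) =
  step (sub Xx ¬b) e (conn-transfer cl sub (cl Xx ¬b (conn-source d) e) d)

module _ (G : Graph n) (B : Subset n) where

  private
    I : ℕ → Subset n
    I = blue G B

  blue-chain : ∀ s t → s ≤ t → I s ⊆ I t
  blue-chain s t = chain-mono {P = I} (blue-mono G B) {s} {t}

  start⊆blue : ∀ t → B ⊆ I t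
  start⊆blue t = blue-chain 0 t z≤n

  -- The colouring of a union X of components is independent of the rest of the graph,
  -- so X gains a vertex in every step until it is finished.
  module _ (X : Subset n) (X-closed : ClosedOff G (_∈ B) (_∈ X)) where

    private
      -- Counting the vertices outside X as coloured turns the progress inside X into a chain of its
      -- own.
      P : ℕ → Subset n
      P t = I t ∪ ∁ X

      P-mono : ∀ t → P t ⊆ P (suc t)
      P-mono t v∈ with x∈p∪q⁻ (I t) (∁ X) v∈
      ... | inj₁ a = x∈p∪q⁺ (inj₁ (blue-mono G B t a))
      ... | inj₂ b = x∈p∪q⁺ (inj₂ b)

      P∩X : ∀ t {v} → v ∈ P t → v ∈ X → v ∈ I t
      P∩X t v∈ v∈X with x∈p∪q⁻ (I t) (∁ X) v∈
      ... | inj₁ a = a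
      ... | inj₂ b = ⊥-elim (x∈∁p⇒x∉p b v∈X)

      -- The forcer of a white vertex of X lies in X or in B, and the component of that vertex lies
      -- in X. A step idle on X therefore offers no new force in X.
      P-stalls : Chain.Stalls P
      P-stalls t still {v} v∈ with v ∈? P (suc t) | x∈p∪q⁻ (I (suc (suc t))) (∁ X) v∈
      ... | yes v∈P | _ = v∈P
      ... | no v∉P  | inj₂ v∈∁X = x∈p∪q⁺ (inj₂ v∈∁X)
      ... | no v∉P  | inj₁ v∈I with next⁻ G v∈I
      ...   | inj₁ old = x∈p∪q⁺ (inj₁ old)
      ...   | inj₂ (u , u∈ , v∉ , e , unique) =
        x∈p∪q⁺ (inj₁ (next⁺ G (inj₂ (u , u∈′ , v∉ ∘ blue-mono G B t , e , unique′))))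
        where
        v∈X : v ∈ X
        v∈X = x∉∁p⇒x∈p (λ v∈∁ → v∉P (x∈p∪q⁺ (inj₂ v∈∁)))
        X-still : ∀ {x} → x ∈ X → x ∉ I t → x ∉ I (suc t)
        X-still x∈X x∉ x∈ = x∉ (P∩X t (still (x∈p∪q⁺ (inj₁ x∈))) x∈X)
        B⊆ : B ⊆ I t
        B⊆ = start⊆blue t
        u∈′ : u ∈ I t
        u∈′ with u ∈? X | u ∈? B
        ... | _      | yes u∈B = B⊆ u∈B
        ... | yes uX | _ = decidable-stable (u ∈? I t) (λ u∉ → X-still uX u∉ u∈)
        ... | no ¬uX | no u∉B = ⊥-elim (¬uX (X-closed v∈X (v∉ ∘ start⊆blue (suc t)) u∉B (adj-sym-true {G = G} e)))
        unique′ : ∀ x → x ∉ I t → adj G u x ≡ true → Conn G (_∈ I t) v x → x ≡ v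
        unique′ x x∉ e′ d = unique x (conn-target d′) e′ d′
          where
          d′ : Conn G (_∈ I (suc t)) v x
          d′ = conn-transfer {G = G} {X = _∈ X} (λ Xx ¬x ¬y → X-closed Xx (¬x ∘ B⊆) (¬y ∘ B⊆)) X-still v∈X d

    -- The inequality on k says that X has at most k white vertices at the start.
    local-time : ∀ {T} → AllBlue G B T → ∀ k → n ≤ k + ∣ B ∪ ∁ X ∣ → ∀ {x} → x ∈ X → x ∈ I k
    local-time {T} a k n≤ {x} x∈X = P∩X k
      (full-after P P-mono P-stalls k n≤ {T} (λ y → x∈p∪q⁺ (inj₁ (Iter⇒blue G B T (a y)))) x) x∈X

-- Every forcer b of a first-step force b → w in the component X of v is replaced by w.
module Swap (G : Graph n) (B : Subset n) (v : Fin n) where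

  X : Subset n
  X = Reach.component G (_∈? B) v

  X-closed : ∀ {x y} → x ∈ X → y ∉ B → adj G x y ≡ true → y ∈ X
  X-closed x∈ y∉ e = Reach.component-complete G (_∈? B) v
    (conn-snoc (Reach.component-sound G (_∈? B) v x∈) e y∉)

  X⇒∉B : ∀ {x} → x ∈ X → x ∉ B
  X⇒∉B x∈ = conn-target (Reach.component-sound G (_∈? B) v x∈)

  F : Subset n
  F = X ∩ next G B

  F⊆X : F ⊆ X
  F⊆X = p∩q⊆p X (next G B)

  forcer : Fin n → Fin n
  forcer w with canForce? G (_∈? B) w
  ... | yes (u , _) = u
  -- A default for vertices that cannot be forced; it does not occur on `F`.
  ... | no _        = w

  forcer-forces : ∀ {w} → w ∈ F → Forces G (_∈ B) (forcer w) w
  forcer-forces {w} w∈ with canForce? G (_∈? B) w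
  ... | yes (u , f) = f
  ... | no ¬f with next⁻ G (p∩q⊆q X (next G B) w∈)
  ...   | inj₁ w∈B = ⊥-elim (X⇒∉B (F⊆X w∈) w∈B)
  ...   | inj₂ f = ⊥-elim (¬f f)

  -- X is a single component of G - B, so w is the only neighbour of its forcer in all of X. This
  -- makes the exchange reversible and `forcer` injective on `F`.
  forcer-unique : ∀ {w x} → w ∈ F → x ∈ X → adj G (forcer w) x ≡ true → x ≡ w
  forcer-unique {w} {x} w∈ x∈ e = let (_ , _ , _ , unique) = forcer-forces w∈ in
    unique x (X⇒∉B x∈) e (conn-trans
      (conn-sym (Reach.component-sound G (_∈? B) v (F⊆X w∈))) (Reach.component-sound G (_∈? B) v x∈))

  IsForcer : VSet n
  IsForcer u = ∃ λ w → w ∈ F × forcer w ≡ u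

  isForcer? : Decidable IsForcer
  isForcer? u = any? (λ w → w ∈? F ×-dec (forcer w ≟ u))

  kept? : Decidable (λ x → x ∈ B × ¬ IsForcer x)
  kept? x = x ∈? B ×-dec ¬? (isForcer? x)

  B′ : Subset n
  B′ = select kept? ∪ F

  kept⇒B′ : ∀ {x} → x ∈ B → ¬ IsForcer x → x ∈ B′
  kept⇒B′ x∈ ¬f = x∈p∪q⁺ (inj₁ (∈-select⁺ kept? (x∈ , ¬f)))

  F⇒B′ : ∀ {x} → x ∈ F → x ∈ B′
  F⇒B′ x∈ = x∈p∪q⁺ (inj₂ x∈)

  ∣B′∣≤∣B∣ : ∣ B′ ∣ ≤ ∣ B ∣
  ∣B′∣≤∣B∣ = begin
    ∣ select kept? ∪ F ∣                    ≤⟨ ∣p∪q∣≤∣p∣+∣q∣ (select kept?) F ⟩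
    ∣ select kept? ∣ + ∣ F ∣                ≤⟨ +-monoʳ-≤ ∣ select kept? ∣ F≤D ⟩
    ∣ select kept? ∣ + ∣ select isForcer? ∣ ≡⟨ disjoint⇒∣p∣+∣q∣≡∣p∪q∣ (select kept?) (select isForcer?)
                                                (λ a b → proj₂ (∈-select⁻ kept? a) (∈-select⁻ isForcer? b)) ⟩
    ∣ select kept? ∪ select isForcer? ∣     ≤⟨ p⊆q⇒∣p∣≤∣q∣ ⊆B ⟩
    ∣ B ∣                                   ∎
    where
    open ≤-Reasoning
    F≤D : ∣ F ∣ ≤ ∣ select isForcer? ∣
    F≤D = injectiveOn⇒∣p∣≤∣q∣ F (select isForcer?) forcer
      (λ w∈ → ∈-select⁺ isForcer? (_ , w∈ , refl))
      (λ {w} {w′} w∈ w′∈ eq → sym (forcer-unique w∈ (F⊆X w′∈)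
        (subst (λ u → adj G u w′ ≡ true) (sym eq) (proj₁ (proj₂ (proj₂ (forcer-forces w′∈)))))))
    ⊆B : select kept? ∪ select isForcer? ⊆ B
    ⊆B x∈ with x∈p∪q⁻ (select kept?) (select isForcer?) x∈
    ... | inj₁ k = proj₁ (∈-select⁻ kept? k)
    ... | inj₂ f with ∈-select⁻ isForcer? f
    ...   | w , w∈ , refl = proj₁ (forcer-forces w∈)

  private
    I J : ℕ → Subset n
    I = blue G B
    J = blue G B′

    B′⊆J : ∀ t → B′ ⊆ J t
    B′⊆J t = start⊆blue G B′ t

  -- A replaced forcer may be white now, but its only neighbour in X belongs to `F` and is blue, so
  -- no white path leaves X through it.
  X-closed-B′ : ∀ {C : VSet n} → (∀ {x} → x ∈ B′ → C x) → ClosedOff G C (_∈ X)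
  X-closed-B′ {C} sub {x} {y} x∈ ¬x ¬y e with y ∈? B
  ... | no y∉B = X-closed x∈ y∉B e
  ... | yes y∈B with isForcer? y
  ...   | no ¬f = ⊥-elim (¬y (sub (kept⇒B′ y∈B ¬f)))
  ...   | yes (w , w∈ , refl) = ⊥-elim (¬x (sub (subst (_∈ B′)
            (sym (forcer-unique w∈ x∈ (adj-sym-true {G = G} e))) (F⇒B′ w∈))))

  -- A forcer outside X lies in B. If it was replaced, its only neighbour in X has been blue from
  -- the start, so every other force in X is still available.
  inside-faster : ∀ t {x} → x ∈ X → x ∈ I (suc t) → x ∈ J t
  inside-faster zero x∈X x∈I = F⇒B′ (x∈p∩q⁺ (x∈X , x∈I))
  inside-faster (suc t) {x} x∈X x∈I with x ∈? J t | next⁻ G x∈I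
  ... | yes x∈J | _ = blue-mono G B′ t x∈J
  ... | no _    | inj₁ old = blue-mono G B′ t (inside-faster t x∈X old)
  ... | no x∉J  | inj₂ (u , u∈ , x∉I , e , unique) =
    next⁺ G (inj₂ (u , u∈′ , x∉J , e , unique′))
    where
    u∈′ : u ∈ J t
    u∈′ with u ∈? X | u ∈? B
    ... | yes u∈X | _ = inside-faster t u∈X u∈
    ... | no u∉X  | no u∉B = ⊥-elim (u∉X (X-closed x∈X u∉B (adj-sym-true {G = G} e)))
    ... | no u∉X  | yes u∈B with isForcer? u
    ...   | no ¬f = B′⊆J t (kept⇒B′ u∈B ¬f)
    ...   | yes (w , w∈ , refl) = ⊥-elim (x∉J (B′⊆J t (subst (_∈ B′) (sym (forcer-unique w∈ x∈X e)) (F⇒B′ w∈))))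
    unique′ : ∀ y → y ∉ J t → adj G u y ≡ true → Conn G (_∈ J t) x y → y ≡ x
    unique′ y _ e′ d = unique y (conn-target d′) e′ d′
      where
      d′ : Conn G (_∈ I (suc t)) x y
      d′ = conn-transfer {G = G} {X = _∈ X} (X-closed-B′ (B′⊆J t)) (λ z∈X z∉ z∈ → z∉ (inside-faster t z∈X z∈)) x∈X d

  -- Each replaced b is forced back at once by its w, which has no white neighbour outside X other
  -- than b. From then on the old forces follow one step late.
  outside-slower : ∀ t {x} → x ∉ X → x ∈ I t → x ∈ J (suc t)
  outside-slower zero {x} x∉X x∈B with x ∈? B′ | isForcer? x
  ... | yes x∈ | _ = blue-mono G B′ 0 x∈
  ... | no x∉  | no ¬f = ⊥-elim (x∉ (kept⇒B′ x∈B ¬f))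
  ... | no x∉  | yes (w , w∈ , refl) = next⁺ G (inj₂
    (w , F⇒B′ w∈ , x∉ , adj-sym-true {G = G} (proj₁ (proj₂ (proj₂ (forcer-forces w∈)))) , unique))
    where
    unique : ∀ y → y ∉ B′ → adj G w y ≡ true → Conn G (_∈ B′) x y → y ≡ x
    unique y y∉ e d with y ∈? B
    ... | no y∉B = ⊥-elim (conn-invariant {G = G} {X = _∉ X}
            (closedOff-compl {G = G} {X = _∈ X} (X-closed-B′ id)) x∉X d (X-closed (F⊆X w∈) y∉B e))
    ... | yes y∈B with isForcer? y
    ...   | no ¬f = ⊥-elim (y∉ (kept⇒B′ y∈B ¬f))
    ...   | yes (w′ , w′∈ , refl) = cong forcer (sym (forcer-unique w′∈ (F⊆X w∈) (adj-sym-true {G = G} e)))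
  outside-slower (suc t) {x} x∉X x∈I with x ∈? J (suc t) | next⁻ G x∈I
  ... | yes x∈J | _ = blue-mono G B′ (suc t) x∈J
  ... | no _    | inj₁ old = blue-mono G B′ (suc t) (outside-slower t x∉X old)
  ... | no x∉J  | inj₂ (u , u∈ , x∉I , e , unique) =
    next⁺ G (inj₂ (u , outside-slower t u∉X u∈ , x∉J , e , unique′))
    where
    x∉B : x ∉ B
    x∉B = x∉I ∘ start⊆blue G B t
    u∉X : u ∉ X
    u∉X u∈X = x∉X (X-closed u∈X x∉B e)
    closed : ClosedOff G (_∈ J (suc t)) (_∉ X)
    closed z∉X z∉J _ e′ y∈X = z∉X (X-closed y∈X
      (λ z∈B → z∉J (blue-chain G B′ 1 (suc t) (s≤s z≤n) (outside-slower 0 z∉X z∈B))) (adj-sym-true {G = G} e′))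
    unique′ : ∀ y → y ∉ J (suc t) → adj G u y ≡ true → Conn G (_∈ J (suc t)) x y → y ≡ x
    unique′ y _ e′ d = unique y (conn-target d′) e′ d′
      where
      d′ : Conn G (_∈ I t) x y
      d′ = conn-transfer {G = G} {X = _∉ X} closed (λ z∉X z∉ z∈ → z∉ (outside-slower t z∉X z∈)) x∉X d

-- Suppose 2 pt₊ ≥ n - Z₊ + 2 and let v turn blue only in the last step. Its component X has at
-- least pt₊ vertices, so at most pt₊ - 2 white vertices lie outside X. After the exchange both
-- parts are finished by time pt₊ - 1.
2pt+Z≤n+1 : (G : Graph n) → ∀ {p} ((k , _) : IsPt G p) → 2 * p + k ≤ suc n
2pt+Z≤n+1 {n} G {p} ispt@(k , (_ , Zmin) , (B , ∣B∣≡k , a , pmin) , _) with 2 * p + k ≤? suc n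
... | yes ok = ok
... | no ¬ok = ⊥-elim (slow p refl (≰⇒> ¬ok))
  where
  k≤n : k ≤ n
  k≤n = subst (_≤ n) ∣B∣≡k (∣p∣≤n B)
  slow : ∀ q → q ≡ p → ¬ (suc (suc n) ≤ 2 * p + k)
  slow zero refl big = <⇒≱ (≤-trans (n≤1+n _) big) k≤n
  slow (suc p′) refl big = 1+n≰n (pt≤ G ispt B′ p′ ∣B′∣≡k allB′)
    where
    late : ∃ λ v → ¬ Iter G B p′ v
    late = ¬∀⟶∃¬ n (Iter G B p′) (Iter? G B p′) (λ all → 1+n≰n (pmin p′ all))
    v = proj₁ late
    open Swap G B v
    v∉B : v ∉ B
    v∉B v∈B = proj₂ late (blue⇒Iter G B p′ (start⊆blue G B p′ v∈B))
    v∈X : v ∈ X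
    v∈X = Reach.component-complete G (_∈? B) v (here v∉B)
    n≤∣X∣+ : n ≤ ∣ X ∣ + ∣ B ∪ ∁ X ∣
    n≤∣X∣+ = ≤-trans (m≤n+m∸n n ∣ X ∣) (+-monoʳ-≤ ∣ X ∣
      (≤-trans (≤-reflexive (sym (∣∁p∣≡n∸∣p∣ X))) (∣q∣≤∣p∪q∣ B (∁ X))))
    p≤∣X∣ : suc p′ ≤ ∣ X ∣
    p≤∣X∣ = ≰⇒> λ ∣X∣≤p′ → proj₂ late (blue⇒Iter G B p′ (blue-chain G B ∣ X ∣ p′ ∣X∣≤p′
      (local-time G B X (λ x∈ _ → X-closed x∈) {suc p′} a ∣ X ∣ n≤∣X∣+ v∈X)))
    k+∣X∣≡ : k + ∣ X ∣ ≡ ∣ B ∪ X ∣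
    k+∣X∣≡ = trans (cong (_+ ∣ X ∣) (sym ∣B∣≡k)) (disjoint⇒∣p∣+∣q∣≡∣p∪q∣ B X (λ b x → X⇒∉B x b))
    k+∣X∣≤n : k + ∣ X ∣ ≤ n
    k+∣X∣≤n = subst (_≤ n) (sym k+∣X∣≡) (∣p∣≤n (B ∪ X))
    s = n ∸ (k + ∣ X ∣)
    n≤s+ : n ≤ s + ∣ B ∪ ∁ (∁ X) ∣
    n≤s+ = begin
      n                         ≡⟨ m∸n+n≡m k+∣X∣≤n ⟨
      s + (k + ∣ X ∣)           ≡⟨ cong (s +_) k+∣X∣≡ ⟩
      s + ∣ B ∪ X ∣             ≤⟨ +-monoʳ-≤ s (p⊆q⇒∣p∣≤∣q∣ sub) ⟩
      s + ∣ B ∪ ∁ (∁ X) ∣       ∎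
      where
      open ≤-Reasoning
      sub : B ∪ X ⊆ B ∪ ∁ (∁ X)
      sub x∈ with x∈p∪q⁻ B X x∈
      ... | inj₁ b = x∈p∪q⁺ (inj₁ b)
      ... | inj₂ x = x∈p∪q⁺ (inj₂ (x∉p⇒x∈∁p (x∈p⇒x∉∁p x)))
    rest : ∀ {x} → x ∉ X → x ∈ blue G B s
    rest x∉ = local-time G B (∁ X)
      (λ x∈ ¬x ¬y e → x∉p⇒x∈∁p (λ y∈ → x∈∁p⇒x∉p x∈ (X-closed y∈ ¬x (adj-sym-true {G = G} e))))
      {suc p′} a s n≤s+ (x∉p⇒x∈∁p x∉)
    1+s≤p′ : suc s ≤ p′
    1+s≤p′ = +-cancelʳ-≤ (2 + p′ + k) _ _ (begin
      suc s + (2 + p′ + k)       ≡⟨ eq₁ s p′ k ⟩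
      2 + (s + (k + suc p′))     ≤⟨ +-monoʳ-≤ 2 (+-monoʳ-≤ s (+-monoʳ-≤ k p≤∣X∣)) ⟩
      2 + (s + (k + ∣ X ∣))      ≡⟨ cong (2 +_) (m∸n+n≡m k+∣X∣≤n) ⟩
      2 + n                      ≤⟨ big ⟩
      2 * suc p′ + k             ≡⟨ eq₂ p′ k ⟩
      p′ + (2 + p′ + k)          ∎)
      where
      open ≤-Reasoning
      eq₁ : ∀ s p k → suc s + (2 + p + k) ≡ 2 + (s + (k + suc p))
      eq₁ = solve-∀
      eq₂ : ∀ p k → 2 * suc p + k ≡ p + (2 + p + k)
      eq₂ = solve-∀
    allB′ : AllBlue G B′ p′
    allB′ x with x ∈? X
    ... | yes x∈ = blue⇒Iter G B′ p′ (inside-faster p′ x∈ (Iter⇒blue G B (suc p′) (a x)))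
    ... | no x∉  = blue⇒Iter G B′ p′ (blue-chain G B′ (suc s) p′ 1+s≤p′ (outside-slower s x∉ (rest x∉)))
    ∣B′∣≡k : ∣ B′ ∣ ≡ k
    ∣B′∣≡k = ≤-antisym (subst (∣ B′ ∣ ≤_) ∣B∣≡k ∣B′∣≤∣B∣) (Zmin B′ (p′ , allB′))

-- The bound Z₊(G) + Z₊(Ḡ) ≥ n − 2

module Boundary (G : Graph n) (rank : Fin n → ℕ) where

  Before : ℕ → VSet n
  Before ρ x = rank x < ρ

  -- For ρ = `rank v` these are the earlier neighbours of v in the fill graph, vertices being
  -- eliminated from the last to the first.
  Touches : ℕ → Fin n → VSet n
  Touches ρ v y = rank y < ρ × ∃ λ z → Conn G (Before ρ) v z × adj G z y ≡ true

  touches? : ∀ ρ v → Decidable (Touches ρ v)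
  touches? ρ v y = rank y <? ρ ×-dec any? (λ z → conn? G (λ x → rank x <? ρ) v z ×-dec (adj G z y Bool.≟ true))

-- An elimination order witnessing that G has treewidth at most k.
record Order (G : Graph n) (k : ℕ) : Set where
  field
    rank     : Fin n → ℕ
    bound    : ℕ
    rank<    : ∀ v → rank v < bound
    rank-inj : ∀ {x y} → rank x ≡ rank y → x ≡ y
  open Boundary G rank public
  field
    width    : ∀ v → ∣ select (touches? (rank v) v) ∣ ≤ k

-- Vertices in the order in which they are coloured, ties being broken by the index.
module ForcingOrder (G : Graph n) (B : Subset n) {T : ℕ} (a : AllBlue G B T) where

  opaque
    time-spec : ∀ v → ∃ λ t → Iter G B t v × t ≤ T × (∀ s → Iter G B s v → t ≤ s)
    time-spec v = least (λ t → Iter? G B t v) T (a v)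

  time : Fin n → ℕ
  time v = proj₁ (time-spec v)

  Iter-time : ∀ v → Iter G B (time v) v
  Iter-time v = proj₁ (proj₂ (time-spec v))

  time-min : ∀ v s → Iter G B s v → time v ≤ s
  time-min v = proj₂ (proj₂ (proj₂ (time-spec v)))

  rank : Fin n → ℕ
  rank v = time v * n + toℕ v

  time<⇒rank< : ∀ {x y} → time x < time y → rank x < rank y
  time<⇒rank< {x} {y} lt = begin-strict
    time x * n + toℕ x <⟨ +-monoʳ-< (time x * n) (toℕ<n x) ⟩
    time x * n + n     ≡⟨ +-comm (time x * n) n ⟩
    suc (time x) * n   ≤⟨ *-monoˡ-≤ n lt ⟩
    time y * n         ≤⟨ m≤m+n _ _ ⟩
    rank y             ∎
    where open ≤-Reasoning

  rank≤⇒time≤ : ∀ {x y} → rank x ≤ rank y → time x ≤ time y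
  rank≤⇒time≤ le = ≮⇒≥ λ lt → <⇒≱ (time<⇒rank< lt) le

  rank-inj : ∀ {x y} → rank x ≡ rank y → x ≡ y
  rank-inj {x} {y} eq = toℕ-injective (+-cancelˡ-≡ (time x * n) _ _
    (trans eq (cong (λ t → t * n + toℕ y) (≤-antisym (rank≤⇒time≤ (≤-reflexive (sym eq))) (rank≤⇒time≤ (≤-reflexive eq))))))

  open Boundary G rank

  -- If v, the vertex of rank ρ, is forced by u, then the components into which that of v splits
  -- no longer touch u, so v takes the place of u.
  width : ∀ ρ {x} → ρ ≤ rank x → ∀ Y → (∀ {y} → y ∈ Y → Touches ρ x y) → ∣ Y ∣ ≤ ∣ B ∣
  width zero {x} _ Y touch = p⊆q⇒∣p∣≤∣q∣ {p = Y} {q = B} (λ y∈ → ⊥-elim (n≮0 (proj₁ (touch y∈))))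
  width (suc ρ) {x} ρ<rx Y touch with any? (λ v → rank v ℕ.≟ ρ)
  ... | no none = width ρ (<⇒≤ ρ<rx) Y λ y∈ → let (ry , z , d , e) = touch y∈ in
    ≤∧≢⇒< (s≤s⁻¹ ry) (λ eq → none (_ , eq)) , z , conn-anti (m≤n⇒m≤1+n) d , e
  ... | yes (v , rv) with conn? G (λ z → rank z <? ρ) x v
  -- Here v is not adjacent to the component of x, so `Y` already lies in the boundary at ρ.
  ...   | no ¬c = width ρ (<⇒≤ ρ<rx) Y λ {y} y∈ → let (ry , z , d , e) = touch y∈; d′ = conn-anti m≤n⇒m≤1+n d in
    ≤∧≢⇒< (s≤s⁻¹ ry) (λ eq → ¬c (subst (Conn G (Before ρ) x) (rank-inj (trans eq (sym rv)))
      (conn-snoc d′ e (λ lt → <⇒≱ lt (≤-reflexive (sym eq)))))) , z , d′ , e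
  ...   | yes c = go (time v) refl (Iter-time v)
    where
    go : ∀ t → t ≡ time v → Iter G B t v → ∣ Y ∣ ≤ ∣ B ∣
    -- If v belongs to B, so does every vertex ranked before it.
    go zero t≡ _ = p⊆q⇒∣p∣≤∣q∣ {p = Y} λ {y} y∈ →
      subst (λ t → Iter G B t y) (n≤0⇒n≡0 (subst (time y ≤_) (sym t≡) (rank≤⇒time≤ (≤-trans (s≤s⁻¹ (proj₁ (touch y∈))) (≤-reflexive (sym rv)))))) (Iter-time y)
    go (suc t) t≡ (inj₁ old) = ⊥-elim (1+n≰n (subst (_≤ t) (sym t≡) (time-min v t old)))
    go (suc t) t≡ (inj₂ (u , u∈ , v∉ , e , unique)) = ≤-trans (∣p∣≤1+∣p-x∣ Y v)
      (≤-trans (≤-reflexive (1+∣p∣≡∣p∪⁅x⁆∣ (Y - v) (λ u∈Y-v → u∉Y (p─q⊆p Y ⁅ v ⁆ u∈Y-v))))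
        (width ρ (<⇒≤ ρ<rx) ((Y - v) ∪ ⁅ u ⁆) touch′))
      where
      late : ∀ {z} → ¬ Before ρ z → ¬ Iter G B t z
      late {z} ¬lt i = ¬lt (subst (rank z <_) rv (time<⇒rank< (subst (time z <_) t≡ (s≤s (time-min z t i)))))
      u<v : rank u < ρ
      u<v = subst (rank u <_) rv (time<⇒rank< (subst (time u <_) t≡ (s≤s (time-min u t u∈))))
      u∉Y : u ∉ Y
      u∉Y u∈Y with touch u∈Y
      ... | _ , z , d , e′ = 1+n≰n (≤-trans (subst (λ w → suc ρ ≤ rank w) z≡v (≮⇒≥ (conn-target d))) (≤-reflexive rv))
        where
        vz : Conn G (Before ρ) v z
        vz = conn-trans (conn-sym c) (conn-anti m≤n⇒m≤1+n d)
        z≡v : z ≡ v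
        z≡v = unique z (late (conn-target vz)) (adj-sym-true {G = G} e′)
          (conn-anti (λ i → decidable-stable (_ <? ρ) (λ ¬lt → late ¬lt i)) vz)
      touch′ : ∀ {y} → y ∈ (Y - v) ∪ ⁅ u ⁆ → Touches ρ x y
      touch′ {y} y∈ with x∈p∪q⁻ (Y - v) ⁅ u ⁆ y∈
      ... | inj₂ y∈u rewrite x∈⁅y⁆⇒x≡y u y∈u = u<v , v , c , adj-sym-true {G = G} e
      ... | inj₁ y∈Y with touch (p─q⊆p Y ⁅ v ⁆ y∈Y)
      ...   | ry , z , d , e′ = ≤∧≢⇒< (s≤s⁻¹ ry) (λ eq → x∉p-x Y v (subst (_∈ Y - v) (rank-inj (trans eq (sym rv))) y∈Y))
                              , z , conn-anti m≤n⇒m≤1+n d , e′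

  order : Order G ∣ B ∣
  order = record
    { rank = rank ; bound = suc T * n ; rank< = rank-bound ; rank-inj = rank-inj
    ; width = λ v → width (rank v) ≤-refl (select (touches? (rank v) v)) (∈-select⁻ (touches? (rank v) v)) }
    where
    rank-bound : ∀ v → rank v < suc T * n
    rank-bound v = begin-strict
      time v * n + toℕ v <⟨ +-monoʳ-< (time v * n) (toℕ<n v) ⟩
      time v * n + n     ≡⟨ +-comm (time v * n) n ⟩
      suc (time v) * n   ≤⟨ *-monoˡ-≤ n (s≤s (proj₁ (proj₂ (proj₂ (time-spec v))))) ⟩
      suc T * n          ∎
      where open ≤-Reasoning

argmax : {P : VSet n} → Decidable P → (r : Fin n → ℕ) (M : ℕ) → (∀ v → r v < M) → ∃ P →
  ∃ λ v → P v × (∀ w → P w → r w ≤ r v)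
argmax {n} {P} P? r M r<M (v₀ , p₀) with least (λ ρ → all? (λ v → P? v →-dec r v <? ρ)) M (λ v _ → r<M v)
... | zero , all , _ = ⊥-elim (n≮0 (all v₀ p₀))
... | suc ρ , all , _ , min with ¬∀⟶∃¬ n _ (λ v → P? v →-dec r v <? ρ) (λ all′ → 1+n≰n (min ρ all′))
...   | v , ¬imp with P? v
...     | no ¬p = ⊥-elim (¬imp (λ p → ⊥-elim (¬p p)))
...     | yes p = v , p , λ w pw → ≤-trans (s≤s⁻¹ (all w pw)) (≮⇒≥ (λ lt → ¬imp (λ _ → lt)))

-- The graph E ∪ E⁻¹ is a chordal supergraph of G; of its chordality only the absence of induced
-- four-cycles is needed.
module Fill {G : Graph n} {k : ℕ} (O : Order G k) where
  open Order O

  E : Fin n → Fin n → Set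
  E v = Touches (rank v) v

  Fadj : Fin n → Fin n → Set
  Fadj x y = E x y ⊎ E y x

  E? : ∀ x → Decidable (E x)
  E? x = touches? (rank x) x

  fadj? : ∀ x y → Dec (Fadj x y)
  fadj? x y = E? x y ⊎-dec E? y x

  fadj-sym : ∀ {x y} → Fadj x y → Fadj y x
  fadj-sym (inj₁ e) = inj₂ e
  fadj-sym (inj₂ e) = inj₁ e

  adj⇒fadj : ∀ {x y} → adj G x y ≡ true → Fadj x y
  adj⇒fadj {x} {y} e with <-cmp (rank x) (rank y)
  ... | tri< lt _ _ = inj₂ (lt , y , here (<-irrefl refl) , adj-sym-true {G = G} e)
  ... | tri> _ _ gt = inj₁ (gt , x , here (<-irrefl refl) , e)
  ... | tri≈ _ eq _ with rank-inj eq
  ...   | refl with trans (sym e) (adj-irrefl G x)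
  ...     | ()

  fadj-max : ∀ {v x} → rank x ≤ rank v → Fadj v x → E v x
  fadj-max le (inj₁ e) = e
  fadj-max le (inj₂ (lt , _)) = ⊥-elim (<⇒≱ lt le)

  -- The component of v, entered from y, lies entirely after y and is adjacent to x.
  fill : ∀ {v x y} → rank x < rank y → E v x → E v y → E y x
  fill {v} {x} {y} lt (_ , z , d , e) (yv , z′ , d′ , e′) =
    lt , z , step (<-irrefl refl) (adj-sym-true {G = G} e′) (conn-anti (λ b → <-trans b yv) (conn-trans (conn-sym d′) d)) , e

  no-cherry : ∀ {v x y} → x ≢ y → rank x ≤ rank v → rank y ≤ rank v → Fadj v x → Fadj v y → Fadj x y
  no-cherry {v} {x} {y} x≢y xv yv fx fy with <-cmp (rank x) (rank y)
  ... | tri< lt _ _ = inj₂ (fill lt (fadj-max xv fx) (fadj-max yv fy))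
  ... | tri> _ _ gt = inj₁ (fill gt (fadj-max yv fy) (fadj-max xv fx))
  ... | tri≈ _ eq _ = ⊥-elim (x≢y (rank-inj eq))

  -- The last of the four vertices has both its neighbours on the cycle before it, and these are
  -- adjacent by `no-cherry`.
  no-C₄ : ∀ {a b x y} → a ≢ b → x ≢ y → Fadj a x → Fadj a y → Fadj b x → Fadj b y → Fadj a b ⊎ Fadj x y
  no-C₄ {a} {b} {x} {y} a≢b x≢y ax ay bx by with ≤-total (rank a) (rank b) | ≤-total (rank x) (rank y)
  no-C₄ {a} {b} {x} {y} a≢b x≢y ax ay bx by | inj₁ a≤b | inj₁ x≤y with ≤-total (rank b) (rank y)
  ... | inj₁ b≤y = inj₁ (no-cherry a≢b (≤-trans a≤b b≤y) b≤y (fadj-sym ay) (fadj-sym by))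
  ... | inj₂ y≤b = inj₂ (no-cherry x≢y (≤-trans x≤y y≤b) y≤b bx by)
  no-C₄ {a} {b} {x} {y} a≢b x≢y ax ay bx by | inj₁ a≤b | inj₂ y≤x with ≤-total (rank b) (rank x)
  ... | inj₁ b≤x = inj₁ (no-cherry a≢b (≤-trans a≤b b≤x) b≤x (fadj-sym ax) (fadj-sym bx))
  ... | inj₂ x≤b = inj₂ (no-cherry x≢y x≤b (≤-trans y≤x x≤b) bx by)
  no-C₄ {a} {b} {x} {y} a≢b x≢y ax ay bx by | inj₂ b≤a | inj₁ x≤y with ≤-total (rank a) (rank y)
  ... | inj₁ a≤y = inj₁ (no-cherry a≢b a≤y (≤-trans b≤a a≤y) (fadj-sym ay) (fadj-sym by))
  ... | inj₂ y≤a = inj₂ (no-cherry x≢y (≤-trans x≤y y≤a) y≤a ax ay)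
  no-C₄ {a} {b} {x} {y} a≢b x≢y ax ay bx by | inj₂ b≤a | inj₂ y≤x with ≤-total (rank a) (rank x)
  ... | inj₁ a≤x = inj₁ (no-cherry a≢b a≤x (≤-trans b≤a a≤x) (fadj-sym ax) (fadj-sym bx))
  ... | inj₂ x≤a = inj₂ (no-cherry x≢y x≤a (≤-trans y≤x x≤a) ax ay)

  -- All other members of a clique are among the at most k earlier neighbours of its last member.
  clique-bound : ∀ K → (∀ {x y} → x ∈ K → y ∈ K → x ≢ y → Fadj x y) → ∣ K ∣ ≤ suc k
  clique-bound K clique with nonempty? K
  ... | no empty = ≤-trans (≤-reflexive (trans (cong ∣_∣ (Empty-unique empty)) (∣⊥∣≡0 n))) z≤n
  ... | yes ne with argmax (_∈? K) rank bound rank< ne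
  ...   | v , v∈ , max = ≤-trans (∣p∣≤1+∣p-x∣ K v) (s≤s (≤-trans (p⊆q⇒∣p∣≤∣q∣ sub) (width v)))
    where
    sub : K - v ⊆ select (E? v)
    sub {x} x∈ = ∈-select⁺ (E? v) (fadj-max (max x x∈K) (clique v∈ x∈K λ { refl → x∉p-x K v x∈ }))
      where x∈K = p─q⊆p K ⁅ v ⁆ x∈

complement-adj : {G : Graph n} → ∀ {x y} → x ≢ y → adj G x y ≡ false → adj (complement G) x y ≡ true
complement-adj {x = x} {y} x≢y e with x ≟ y
... | yes eq = ⊥-elim (x≢y eq)
... | no _ rewrite e = refl

-- v is the last vertex, in the order of Ḡ, that precedes some non-neighbour y in the fill graph. The set X covers all
-- non-edges of the fill graph: one avoiding X lies either among the later vertices, against the choice of v,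
-- or away from the component of v, and then closes an induced four-cycle with v and y.
orders-bound : (G : Graph n) → ∀ {k l} → Order G k → Order (complement G) l → n ≤ suc k + suc l
orders-bound {n} G {k} {l} O Ō = main (any? nonpair?)
  where
  open Fill O
  module C = Order Ō
  Ḡ = complement G

  non⇒coadj : ∀ {x y} → x ≢ y → ¬ Fadj x y → adj Ḡ x y ≡ true
  non⇒coadj {x} {y} x≢y ¬f with adj G x y Bool.≟ true
  ... | yes e = ⊥-elim (¬f (adj⇒fadj e))
  ... | no ¬e = complement-adj {G = G} x≢y (Bool.¬-not ¬e)

  Nonpair : VSet n
  Nonpair v = ∃ λ y → C.rank v < C.rank y × ¬ Fadj v y

  nonpair? : Decidable Nonpair
  nonpair? v = any? (λ y → C.rank v <? C.rank y ×-dec ¬? (fadj? v y))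

  main : Dec (∃ Nonpair) → n ≤ suc k + suc l
  -- The fill graph is complete, so all n vertices form one clique.
  main (no none) = ≤-trans (≤-reflexive (sym (∣⊤∣≡n n))) (≤-trans (clique-bound ⊤ clique) (m≤m+n _ _))
    where
    clique : ∀ {x y} → x ∈ ⊤ → y ∈ ⊤ → x ≢ y → Fadj x y
    clique {x} {y} _ _ x≢y = decidable-stable (fadj? x y) λ ¬f → contra ¬f (<-cmp (C.rank x) (C.rank y))
      where
      contra : ¬ Fadj x y → ¬ Tri (C.rank x < C.rank y) (C.rank x ≡ C.rank y) (C.rank y < C.rank x)
      contra ¬f (tri< lt _ _) = none (x , y , lt , ¬f)
      contra ¬f (tri≈ _ eq _) = x≢y (C.rank-inj eq)
      contra ¬f (tri> _ _ gt) = none (y , x , gt , ¬f ∘ fadj-sym)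
  main (yes some) with argmax nonpair? C.rank C.bound C.rank< some
  ... | v , (y , v<y , ¬vy) , max = begin
    n                       ≤⟨ m≤n+m∸n n ∣ X ∣ ⟩
    ∣ X ∣ + (n ∸ ∣ X ∣)     ≡⟨ cong (∣ X ∣ +_) (∣∁p∣≡n∸∣p∣ X) ⟨
    ∣ X ∣ + ∣ ∁ X ∣         ≤⟨ +-mono-≤ ∣X∣≤ (clique-bound (∁ X) clique) ⟩
    suc l + suc k           ≡⟨ +-comm (suc l) (suc k) ⟩
    suc k + suc l           ∎
    where
    open ≤-Reasoning
    N : Subset n
    N = select (C.touches? (C.rank v) v)
    X : Subset n
    X = N ∪ ⁅ v ⁆
    ∣X∣≤ : ∣ X ∣ ≤ suc l
    ∣X∣≤ = ≤-trans (∣p∪q∣≤∣p∣+∣q∣ N ⁅ v ⁆)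
      (≤-trans (≤-reflexive (trans (cong (∣ N ∣ +_) (∣⁅x⁆∣≡1 v)) (+-comm _ 1))) (s≤s (C.width v)))
    Comp : VSet n
    Comp z = Conn Ḡ (C.Before (C.rank v)) v z
    v∈Comp : Comp v
    v∈Comp = here (<-irrefl refl)
    y∈Comp : Comp y
    y∈Comp = conn-snoc v∈Comp (non⇒coadj (λ { refl → <-irrefl refl v<y }) ¬vy) (<⇒≯ v<y)
    ∁X⇒≢v : ∀ {z} → z ∈ ∁ X → z ≢ v
    ∁X⇒≢v z∈ refl = x∈∁p⇒x∉p z∈ (x∈p∪q⁺ (inj₂ (x∈⁅x⁆ v)))
    leave : ∀ {w z} → Comp w → z ∈ ∁ X → adj Ḡ w z ≡ true → Comp z
    leave {w} {z} cw z∈ e = conn-snoc cw e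
      (λ lt → x∈∁p⇒x∉p z∈ (x∈p∪q⁺ (inj₁ (∈-select⁺ (C.touches? (C.rank v) v) (lt , w , cw , e)))))
    later : ∀ {z} → Comp z → z ∈ ∁ X → C.rank v < C.rank z
    later cz z∈ = ≤∧≢⇒< (≮⇒≥ (conn-target cz)) (λ eq → ∁X⇒≢v z∈ (sym (C.rank-inj eq)))
    within : ∀ {a b} → a ∈ ∁ X → b ∈ ∁ X → a ≢ b → Comp a → ¬ Fadj a b → ⊥
    within {a} {b} a∈ b∈ a≢b ca ¬f with <-cmp (C.rank a) (C.rank b)
    ... | tri≈ _ eq _ = a≢b (C.rank-inj eq)
    ... | tri< lt _ _ = <⇒≱ (later ca a∈) (max a (b , lt , ¬f))
    ... | tri> _ _ gt = <⇒≱ (later (leave ca b∈ (non⇒coadj a≢b ¬f)) b∈) (max b (a , gt , ¬f ∘ fadj-sym))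
    comp? : Decidable Comp
    comp? = conn? Ḡ (λ x → C.rank x <? C.rank v) v
    cross : ∀ {w z} → Comp w → z ∈ ∁ X → ¬ Comp z → Fadj w z
    cross {w} {z} cw z∈ ¬cz = decidable-stable (fadj? w z)
      (λ ¬f → ¬cz (leave cw z∈ (non⇒coadj (λ { refl → ¬cz cw }) ¬f)))
    clique : ∀ {a b} → a ∈ ∁ X → b ∈ ∁ X → a ≢ b → Fadj a b
    clique {a} {b} a∈ b∈ a≢b with fadj? a b | comp? a | comp? b
    ... | yes f | _ | _ = f
    ... | no ¬f | yes ca | _ = ⊥-elim (within a∈ b∈ a≢b ca ¬f)
    ... | no ¬f | no _ | yes cb = ⊥-elim (within b∈ a∈ (a≢b ∘ sym) cb (¬f ∘ fadj-sym))
    ... | no ¬f | no ¬ca | no ¬cb with no-C₄ (λ { refl → <-irrefl refl v<y }) a≢b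
            (cross v∈Comp a∈ ¬ca) (cross v∈Comp b∈ ¬cb) (cross y∈Comp a∈ ¬ca) (cross y∈Comp b∈ ¬cb)
    ...   | inj₁ vy = ⊥-elim (¬vy vy)
    ...   | inj₂ f  = f

n≤Z+Z̄+2 : (G : Graph n) → ∀ {k l} → IsZplus G k → IsZplus (complement G) l → n ≤ k + l + 2
n≤Z+Z̄+2 {n} G {k} {l} ((B , refl , T , a) , _) ((B̄ , refl , T̄ , ā) , _) =
  ≤-trans (orders-bound G (ForcingOrder.order G B {T} a) (ForcingOrder.order (complement G) B̄ {T̄} ā))
    (≤-reflexive (eq k l))
  where
  eq : ∀ k l → suc k + suc l ≡ k + l + 2
  eq = solve-∀

-- The Nordhaus–Gaddum bounds

pt-sum-upper : (G : Graph n) → ∀ {p q} → IsPt G p → IsPt (complement G) q → 2 * (p + q) ≤ n + 4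
pt-sum-upper {n} G {p} {q} P@(k , z , _) Q@(l , z̄ , _) = +-cancelʳ-≤ (k + l) _ _ (begin
  2 * (p + q) + (k + l)            ≡⟨ eq₁ p q k l ⟩
  (2 * p + k) + (2 * q + l)        ≤⟨ +-mono-≤ (2pt+Z≤n+1 G P) (2pt+Z≤n+1 (complement G) Q) ⟩
  suc n + suc n                    ≡⟨ eq₂ n ⟩
  n + (2 + n)                      ≤⟨ +-monoʳ-≤ n (+-monoʳ-≤ 2 (n≤Z+Z̄+2 G z z̄)) ⟩
  n + (2 + (k + l + 2))            ≡⟨ eq₃ n k l ⟩
  n + 4 + (k + l)                  ∎)
  where
  open ≤-Reasoning
  eq₁ : ∀ p q k l → 2 * (p + q) + (k + l) ≡ (2 * p + k) + (2 * q + l)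
  eq₁ = solve-∀
  eq₂ : ∀ n → suc n + suc n ≡ n + (2 + n)
  eq₂ = solve-∀
  eq₃ : ∀ n k l → n + (2 + (k + l + 2)) ≡ n + 4 + (k + l)
  eq₃ = solve-∀

-- Time 0 means that a minimum forcing set is the whole vertex set, whereas for an edge uw all
-- vertices but w suffice, u forcing w.
pt≡0⇒edgeless : (G : Graph n) → IsPt G 0 → ∀ u w → adj G u w ≢ true
pt≡0⇒edgeless {n} G (k , (_ , Zmin) , (B , ∣B∣≡k , a , _) , _) u w e =
  <⇒≱ (x∈p⇒∣p-x∣<∣p∣ (∈⊤ {x = w})) (begin
    ∣ ⊤ {n} ∣   ≡⟨ trans (∣⊤∣≡n n) (sym (full⇒∣p∣≡n a)) ⟩
    ∣ B ∣       ≡⟨ ∣B∣≡k ⟩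
    k           ≤⟨ Zmin (⊤ - w) (1 , all) ⟩
    ∣ ⊤ - w ∣   ∎)
  where
  open ≤-Reasoning
  u≢w : u ≢ w
  u≢w refl with trans (sym e) (adj-irrefl G u)
  ... | ()
  all : AllBlue G (⊤ - w) 1
  all v with v ≟ w
  ... | no v≢w = inj₁ (x∈p∧x≢y⇒x∈p-y ∈⊤ v≢w)
  ... | yes refl = inj₂ (u , x∈p∧x≢y⇒x∈p-y ∈⊤ u≢w , x∉p-x ⊤ w , e ,
        λ x x∉ _ _ → decidable-stable (x ≟ w) (λ x≢w → x∉ (x∈p∧x≢y⇒x∈p-y ∈⊤ x≢w)))

pt-sum-lower : 2 ≤ n → (G : Graph n) → ∀ {p q} → IsPt G p → IsPt (complement G) q → 1 ≤ p + q
pt-sum-lower _ G {suc p} {q} _ _ = s≤s z≤n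
pt-sum-lower _ G {zero} {suc q} _ _ = s≤s z≤n
pt-sum-lower {suc (suc n)} _ G {zero} {zero} P Q = ⊥-elim (contra (adj G zero (suc zero)) refl)
  where
  contra : ∀ b → adj G zero (suc zero) ≢ b
  contra true  e = pt≡0⇒edgeless G P zero (suc zero) e
  contra false e = pt≡0⇒edgeless (complement G) Q zero (suc zero) (complement-adj {G = G} (λ ()) e)
pt-sum-lower {suc zero} (s≤s ())

edgeless : ∀ n → Graph n
edgeless n = record { adj = λ _ _ → false ; adj-sym = λ _ _ → refl ; adj-irrefl = λ _ → refl }

pt-edgeless : ∀ n → IsPt (edgeless n) 0
pt-edgeless n = n , ((⊤ , ∣⊤∣≡n n , 0 , λ _ → ∈⊤) , Zmin) , (⊤ , ∣⊤∣≡n n , (λ _ → ∈⊤) , λ _ _ → z≤n) , λ _ _ _ _ → z≤n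
  where
  stuck : ∀ B t {v} → Iter (edgeless n) B t v → v ∈ B
  stuck B zero i = i
  stuck B (suc t) (inj₁ i) = stuck B t i
  stuck B (suc t) (inj₂ (_ , _ , _ , () , _))
  Zmin : ∀ B → IsPSDForcingSet (edgeless n) B → n ≤ ∣ B ∣
  Zmin B (t , a) = ≤-reflexive (sym (full⇒∣p∣≡n (λ v → stuck B t (a v))))

-- In a complete graph a force is possible only when a single white vertex is left.
pt-complete≤1 : ∀ {q} → IsPt (complement (edgeless n)) q → q ≤ 1
pt-complete≤1 {n} {q} Q@(l , _ , (B , ∣B∣≡l , a , _) , _) = pt≤ K Q B 1 ∣B∣≡l (all (any? (canForce? K (_∈? B))))
  where
  K = complement (edgeless n)
  K-adj : ∀ {x y} → x ≢ y → adj K x y ≡ true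
  K-adj x≢y = complement-adj {G = edgeless n} x≢y refl
  all : Dec (∃ (CanForce K (_∈ B))) → AllBlue K B 1
  all (no none) v = inj₁ (stuck q (a v))
    where
    stuck : ∀ t {v} → Iter K B t v → v ∈ B
    stuck zero i = i
    stuck (suc t) (inj₁ i) = stuck t i
    stuck (suc t) {v} (inj₂ (u , f)) = decidable-stable (v ∈? B) (λ v∉ → none (v , u , forces-mono (stuck t) v∉ f))
  all (yes (w , u , f@(u∈ , w∉ , e , unique))) v with v ∈? B
  ... | yes v∈ = inj₁ v∈
  ... | no v∉ with w ≟ v
  ...   | yes refl = inj₂ (u , f)
  ...   | no w≢v = ⊥-elim (w≢v (sym (unique v v∉ (K-adj {u} {v} (λ { refl → v∉ u∈ })) (step w∉ (K-adj {w} {v} w≢v) (here v∉)))))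

-- The extremal family

-- Each edge is listed once, from its smaller end; the last clause is the path starting at 2.
arc : ℕ → ℕ → Bool
arc 0 1 = true
arc 0 2 = true
arc 0 3 = true
arc 0 5 = true
arc 0 6 = true
arc 0 _ = false
arc 1 3 = true
arc 1 4 = true
arc 1 6 = true
arc 1 7 = true
arc 1 _ = false
arc (suc (suc i)) j = 3 + i ≡ᵇ j

arc-irrefl : ∀ i → arc i i ≡ false
arc-irrefl 0 = refl
arc-irrefl 1 = refl
arc-irrefl (suc (suc i)) = go i
  where
  go : ∀ i → (suc i ≡ᵇ i) ≡ false
  go zero = refl
  go (suc i) = go i

Gr : ∀ n → Graph n
Gr n = record
  { adj        = λ i j → arc (toℕ i) (toℕ j) ∨ arc (toℕ j) (toℕ i)
  ; adj-sym    = λ i j → Bool.∨-comm (arc (toℕ i) (toℕ j)) _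
  ; adj-irrefl = λ i → cong₂ _∨_ (arc-irrefl (toℕ i)) (arc-irrefl (toℕ i))
  }

Full : ∀ {n} → Subset n → Set
Full S = ∀ x → x ∈ S

full? : ∀ {n} → Decidable (Full {n})
full? S = all? (_∈? S)

H : Graph 8
H = Gr 8

-- The cut vertex to which the path 8, 9, … is attached.
c : Fin 8
c = # 7

-- Seen from the first eight vertices, 8 and 9 represent all further vertices.
H̄⁺ : Graph 10
H̄⁺ = complement (Gr 10)

pad : Subset 8 → Subset 10
pad S = S ++ inside ∷ inside ∷ []

-- If c is blue at time s and H at time T, then a path of length L is blue at time s + L at the earliest;
-- excluding Fast₃ yields s + T ≥ 5, whence the bound (L + 5) / 2.
Fast₃ : Subset 8 → Set
Fast₃ S = ∣ S ∣ ≡ 3 × (c ∈ S × Full (blue H S 4) ⊎ c ∈ blue H S 1 × Full (blue H S 3) ⊎ c ∈ blue H S 2 × Full (blue H S 2))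

fast₃? : Decidable Fast₃
fast₃? S = (∣ S ∣ ℕ.≟ 3) ×-dec
  ((c ∈? S ×-dec full? (blue H S 4)) ⊎-dec (c ∈? blue H S 1 ×-dec full? (blue H S 3)) ⊎-dec (c ∈? blue H S 2 ×-dec full? (blue H S 2)))

-- With one starting vertex on the path, nothing happens in H before c is reached.
Slow₂ : Subset 8 → Set
Slow₂ S = ∣ S ∣ ≡ 2 × c ∉ S × next H S ⊆ S × ¬ Full (blue H (S ∪ ⁅ c ⁆) 4)

-- Time 8 expresses that S together with c forces H, eight steps being enough for eight vertices. A
-- member would be such an S that is not slow.
fast₂? : Decidable (λ S → ∣ S ∣ ≤ 2 × Full (blue H (S ∪ ⁅ c ⁆) 8) × ¬ Slow₂ S)
fast₂? S = (∣ S ∣ ≤? 2) ×-dec full? (blue H (S ∪ ⁅ c ⁆) 8) ×-dec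
  ¬? ((∣ S ∣ ℕ.≟ 2) ×-dec ¬? (c ∈? S) ×-dec (next H S ⊆? S) ×-dec ¬? (full? (blue H (S ∪ ⁅ c ⁆) 4)))

-- The index counts the white vertices among the first eight. Here these are all five vertices
-- outside a set of size n - 5.
cofast₅? : Decidable (λ S → ∣ S ∣ ≡ 3 × Full (blue H̄⁺ (pad S) 2))
cofast₅? S = (∣ S ∣ ℕ.≟ 3) ×-dec full? (blue H̄⁺ (pad S) 2)

-- The fifth white vertex lies on the path and is coloured first, by a u adjacent in G to the other
-- four; one step remains for those.
cofast₄? : Decidable (λ S → ∣ S ∣ ≡ 4 × (∃ λ u → ∀ x → x ∉ S → adj H u x ≡ true) × Full (next H̄⁺ (pad S)))
cofast₄? S = (∣ S ∣ ℕ.≟ 4) ×-dec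
  any? (λ u → all? (λ x → ¬? (x ∈? S) →-dec (adj H u x Bool.≟ true))) ×-dec full? (next H̄⁺ (pad S))

seed : Subset 8
seed = outside ∷ outside ∷ inside ∷ outside ∷ outside ∷ outside ∷ inside ∷ inside ∷ []

-- Finite checks over the subsets of the first eight vertices

opaque
  unfolding Reach.component canForce? next

  no-fast₃ : ¬ ∃ Fast₃
  no-fast₃ = toWitnessFalse {a? = anySubset? fast₃?} tt

  no-fast₂ : ¬ ∃ λ S → ∣ S ∣ ≤ 2 × Full (blue H (S ∪ ⁅ c ⁆) 8) × ¬ Slow₂ S
  no-fast₂ = toWitnessFalse {a? = anySubset? fast₂?} tt

  no-cofast₅ : ¬ ∃ λ S → ∣ S ∣ ≡ 3 × Full (blue H̄⁺ (pad S) 2)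
  no-cofast₅ = toWitnessFalse {a? = anySubset? cofast₅?} tt

  no-cofast₄ : ¬ ∃ λ S → ∣ S ∣ ≡ 4 × (∃ λ u → ∀ x → x ∉ S → adj H u x ≡ true) × Full (next H̄⁺ (pad S))
  no-cofast₄ = toWitnessFalse {a? = anySubset? cofast₄?} tt

  seed-forces : Full (blue (complement H) seed 3)
  seed-forces = toWitness {a? = full? (blue (complement H) seed 3)} tt

-- Adjacency along the pendant path

link : ℕ → ℕ → Bool
link i j = arc i j ∨ arc j i

≡ᵇ-refl : ∀ i → (i ≡ᵇ i) ≡ true
≡ᵇ-refl zero    = refl
≡ᵇ-refl (suc i) = ≡ᵇ-refl i

≡ᵇ-true : ∀ {i j} → (i ≡ᵇ j) ≡ true → i ≡ j
≡ᵇ-true {i} {j} e = ≡ᵇ⇒≡ i j (subst T (sym e) _)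

∨-true : ∀ {a b} → a ∨ b ≡ true → a ≡ true ⊎ b ≡ true
∨-true {true}  _ = inj₁ refl
∨-true {false} e = inj₂ e

link-tail : ∀ i j → 7 ≤ i → link i j ≡ true → j ≡ suc i ⊎ i ≡ suc j ⊎ (i ≡ 7 × j ≡ 1)
link-tail i j 7≤i = subst (λ i → link i j ≡ true → j ≡ suc i ⊎ i ≡ suc j ⊎ (i ≡ 7 × j ≡ 1)) (m+[n∸m]≡n 7≤i) (go (i ∸ 7) j)
  where
  go : ∀ i j → link (7 + i) j ≡ true → j ≡ 8 + i ⊎ 7 + i ≡ suc j ⊎ (7 + i ≡ 7 × j ≡ 1)
  go i j e with ∨-true {arc (7 + i) j} e
  go i       j             e | inj₁ e₁ = inj₁ (sym (≡ᵇ-true e₁))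
  go i       0             e | inj₂ ()
  go zero    1             e | inj₂ _ = inj₂ (inj₂ (refl , refl))
  go (suc i) 1             e | inj₂ ()
  go i       (suc (suc j)) e | inj₂ e₂ = inj₂ (inj₁ (sym (≡ᵇ-true e₂)))

link-sym : ∀ i j → link i j ≡ true → link j i ≡ true
link-sym i j e = trans (Bool.∨-comm (arc j i) (arc i j)) e

link-far : ∀ i j → 8 ≤ i → link i j ≡ true → j ≡ suc i ⊎ i ≡ suc j
link-far i j 8≤i e with link-tail i j (<⇒≤ 8≤i) e
... | inj₁ a = inj₁ a
... | inj₂ (inj₁ b) = inj₂ b
... | inj₂ (inj₂ (refl , _)) = ⊥-elim (1+n≰n 8≤i)

-- Only c joins the first eight vertices to the path.
link-core : ∀ i j → i < 7 → link i j ≡ true → j < 8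
link-core i j i<7 e with j <? 8
... | yes j<8 = j<8
... | no j≮8 with link-far j i (≮⇒≥ j≮8) (link-sym i j e)
...   | inj₁ refl = ⊥-elim (j≮8 (≤-trans (<⇒≤ i<7) (n≤1+n 7)))
...   | inj₂ refl = ⊥-elim (j≮8 (s≤s i<7))

colink : ℕ → ℕ → Bool
colink i j = if i ≡ᵇ j then false else not (link i j)

adj-colink : (a b : Fin n) → adj (complement (Gr n)) a b ≡ colink (toℕ a) (toℕ b)
adj-colink a b = cong (λ z → if z then false else not (link (toℕ a) (toℕ b))) does-≡
  where
  does-≡ : does (a ≟ b) ≡ (toℕ a ≡ᵇ toℕ b)
  does-≡ with a ≟ b
  ... | yes refl = sym (≡ᵇ-refl (toℕ a))
  ... | no a≢b with toℕ a ≡ᵇ toℕ b in e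
  ...   | true = ⊥-elim (a≢b (toℕ-injective (≡ᵇ-true e)))
  ...   | false = refl

-- All vertices from 9 on look alike from the first eight.
colink-⊓9 : ∀ i j → j < 8 → colink (i ⊓ 9) j ≡ colink i j
colink-⊓9 0 j _ = refl
colink-⊓9 1 j _ = refl
colink-⊓9 2 j _ = refl
colink-⊓9 3 j _ = refl
colink-⊓9 4 j _ = refl
colink-⊓9 5 j _ = refl
colink-⊓9 6 j _ = refl
colink-⊓9 7 j _ = refl
colink-⊓9 8 j _ = refl
colink-⊓9 (suc (suc (suc (suc (suc (suc (suc (suc (suc i))))))))) j j<8 rewrite ⊓-zeroʳ i = far j j<8
  where
  far : ∀ j → j < 8 → colink 9 j ≡ colink (9 + i) j
  far 0 _ = refl
  far 1 _ = refl
  far 2 _ = refl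
  far 3 _ = refl
  far 4 _ = refl
  far 5 _ = refl
  far 6 _ = refl
  far 7 _ = refl
  far (suc (suc (suc (suc (suc (suc (suc (suc j)))))))) (s≤s (s≤s (s≤s (s≤s (s≤s (s≤s (s≤s (s≤s ()))))))))

-- Subsets of a disjoint union

∣p++q∣ : ∀ {m l} (p : Subset m) (q : Subset l) → ∣ p ++ q ∣ ≡ ∣ p ∣ + ∣ q ∣
∣p++q∣ [] q = refl
∣p++q∣ (inside  ∷ p) q = cong suc (∣p++q∣ p q)
∣p++q∣ (outside ∷ p) q = ∣p++q∣ p q

∈-++ˡ⁺ : ∀ {m l} {p : Subset m} {q : Subset l} {i} → i ∈ p → i ↑ˡ l ∈ p ++ q
∈-++ˡ⁺ here = here
∈-++ˡ⁺ (there i∈) = there (∈-++ˡ⁺ i∈)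

∈-++ˡ⁻ : ∀ {m l} {p : Subset m} {q : Subset l} {i} → i ↑ˡ l ∈ p ++ q → i ∈ p
∈-++ˡ⁻ {p = _ ∷ _} {i = zero} here = here
∈-++ˡ⁻ {p = _ ∷ _} {i = suc i} (there i∈) = there (∈-++ˡ⁻ i∈)

∈-++ʳ⁺ : ∀ {m l} (p : Subset m) {q : Subset l} {i} → i ∈ q → m ↑ʳ i ∈ p ++ q
∈-++ʳ⁺ [] i∈ = i∈
∈-++ʳ⁺ (_ ∷ p) i∈ = there (∈-++ʳ⁺ p i∈)

∈-++ʳ⁻ : ∀ {m l} (p : Subset m) {q : Subset l} {i} → m ↑ʳ i ∈ p ++ q → i ∈ q
∈-++ʳ⁻ [] i∈ = i∈
∈-++ʳ⁻ (_ ∷ p) (there i∈) = ∈-++ʳ⁻ p i∈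

data Split (m : ℕ) {l : ℕ} : Fin (m + l) → Set where
  left  : (i : Fin m) → Split m (i ↑ˡ l)
  right : (j : Fin l) → Split m (m ↑ʳ j)

split : ∀ m {l} (v : Fin (m + l)) → Split m v
split m v with splitAt m v in e
... | inj₁ i = subst (Split m) (splitAt⁻¹-↑ˡ e) (left i)
... | inj₂ j = subst (Split m) (splitAt⁻¹-↑ʳ {m} e) (right j)

-- The list may contain repetitions and numbers that are not vertices, as happens for the neighbours
-- of the end of the path.
∣p∣≤length : (p : Subset n) (is : List ℕ) → (∀ {x} → x ∈ p → toℕ x List.∈ is) → ∣ p ∣ ≤ length is
∣p∣≤length {n} p [] sub = ≤-reflexive (trans (cong ∣_∣ (Empty-unique (λ (x , x∈) → none (sub x∈)))) (∣⊥∣≡0 n))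
  where
  none : ∀ {i} → ¬ (i List.∈ [])
  none ()
∣p∣≤length {n} p (i ∷ is) sub with any? (λ x → x ∈? p ×-dec (toℕ x ℕ.≟ i))
... | no none = m≤n⇒m≤1+n (∣p∣≤length p is tail)
  where
  tail : ∀ {x} → x ∈ p → toℕ x List.∈ is
  tail x∈ with sub x∈
  ... | here eq = ⊥-elim (none (_ , x∈ , eq))
  ... | there t = t
... | yes (y , y∈ , y≡i) = ≤-trans (∣p∣≤1+∣p-x∣ p y) (s≤s (∣p∣≤length (p - y) is tail))
  where
  tail : ∀ {x} → x ∈ p - y → toℕ x List.∈ is
  tail x∈ with sub (p─q⊆p p ⁅ y ⁆ x∈)
  ... | here eq = ⊥-elim (x∉p-x p y (subst (_∈ p - y) (toℕ-injective (trans eq (sym y≡i))) x∈))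
  ... | there t = t

∣p∣≤1⇒≡ : (p : Subset n) → ∣ p ∣ ≤ 1 → ∀ {x y} → x ∈ p → y ∈ p → y ≡ x
∣p∣≤1⇒≡ p ≤1 {x} {y} x∈ y∈ = decidable-stable (y ≟ x) λ y≢x → n≮0 (≤-trans
  (x∈p⇒∣p-x∣<∣p∣ (x∈p∧x≢y⇒x∈p-y y∈ y≢x)) (s≤s⁻¹ (≤-trans (x∈p⇒∣p-x∣<∣p∣ x∈) ≤1)))

-- Propagation time of the family

module Tail (L : ℕ) where

  G : Graph (8 + L)
  G = Gr (8 + L)

  adj-core : ∀ a b → adj G (a ↑ˡ L) (b ↑ˡ L) ≡ adj H a b
  adj-core a b = cong₂ link (toℕ-↑ˡ a L) (toℕ-↑ˡ b L)

  last : Fin (8 + L)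
  last = fromℕ (7 + L)

  -- H is an induced subgraph whose white vertices are white in G, so its white paths are white in G
  -- and cannot obstruct a force available there.
  core-force : {B : VSet (8 + L)} {A : Subset 8} → (∀ {h} → B (h ↑ˡ L) → h ∈ A) →
    ∀ {u w} → Forces G B (u ↑ˡ L) (w ↑ˡ L) → w ∈ next H A
  core-force {B} {A} sub {u} {w} f@(bu , _) with w ∈? A
  ... | yes w∈ = next⁺ H (inj₁ w∈)
  ... | no w∉  = next⁺ H (inj₂ (u , Simulation.forces-sim {G = G} {H} {B} {_∈ A}
      (λ a a′ → a ≡ a′ ↑ˡ L) (λ {x′} ¬x′ → x′ ↑ˡ L , refl , ¬x′ ∘ sub) (λ { {a′ = a} {b′ = b} refl refl _ → adj-core a b })
      refl (sub bu) refl w∉ (λ eq _ → sym (↑ˡ-injective L _ _ eq)) f))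

  tail-core-adj : ∀ {j h} → adj G (8 ↑ʳ j) (h ↑ˡ L) ≡ true → h ≡ c × toℕ (8 ↑ʳ j) ≡ 8
  tail-core-adj {j} {h} e with link-far _ _ (m≤m+n 8 _)
      (subst (λ i → link i (toℕ (h ↑ˡ L)) ≡ true) (toℕ-↑ʳ 8 j) e)
  ... | inj₁ eq = ⊥-elim (<⇒≱ (toℕ<n h) (subst (8 ≤_) (trans (sym eq) (toℕ-↑ˡ h L)) (≤-trans (m≤m+n 8 (toℕ j)) (n≤1+n _))))
  ... | inj₂ eq = toℕ-injective h≡7 , trans (toℕ-↑ʳ 8 j) (trans eq (cong suc (trans (toℕ-↑ˡ h L) h≡7)))
    where
    h≡ : 7 + toℕ j ≡ toℕ h
    h≡ = trans (suc-injective eq) (toℕ-↑ˡ h L)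
    h≡7 : toℕ h ≡ 7
    h≡7 = ≤-antisym (s≤s⁻¹ (toℕ<n h)) (subst (7 ≤_) h≡ (m≤m+n 7 _))

  tail-adj : ∀ {u} {v : Fin (8 + L)} → 8 ≤ toℕ v → adj G u v ≡ true →
    7 ≤ toℕ u × toℕ v ≤ suc (toℕ u) × toℕ u ≤ suc (toℕ v)
  tail-adj {u} {v} 8≤v e with link-far (toℕ v) (toℕ u) 8≤v (link-sym (toℕ u) (toℕ v) e)
  ... | inj₁ eq = subst (λ z → 7 ≤ z × toℕ v ≤ suc z × z ≤ suc (toℕ v)) (sym eq)
        (≤-trans (<⇒≤ 8≤v) (n≤1+n _) , ≤-trans (n≤1+n _) (n≤1+n _) , ≤-refl)
  ... | inj₂ eq = s≤s⁻¹ (subst (8 ≤_) eq 8≤v) , ≤-reflexive eq , ≤-trans (n≤1+n _) (≤-trans (≤-reflexive (sym eq)) (n≤1+n _))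

  right-≥8 : ∀ (j : Fin L) → 8 ≤ toℕ (8 ↑ʳ j)
  right-≥8 j = subst (8 ≤_) (sym (toℕ-↑ʳ 8 j)) (m≤m+n 8 _)

  left-<8 : ∀ (h : Fin 8) → toℕ (h ↑ˡ L) < 8
  left-<8 h = subst (_< 8) (sym (toℕ-↑ˡ h L)) (toℕ<n h)

  left-7⇒c : ∀ {h : Fin 8} → 7 ≤ toℕ (h ↑ˡ L) → h ≡ c
  left-7⇒c {h} 7≤ = toℕ-injective (≤-antisym (s≤s⁻¹ (toℕ<n h)) (subst (7 ≤_) (toℕ-↑ˡ h L) 7≤))

  blueH : Subset 8 → ℕ → Subset 8
  blueH = blue H

  module NoTail (S : Subset 8) (Q : Subset L) (Q-empty : ∀ j → j ∉ Q) where

    B = S ++ Q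

    -- A vertex at distance d beyond c is blue at time t only if c is blue in H by time t - d, so
    -- the path never helps the core.
    Core Far : ℕ → Set
    Core t = ∀ {h} → Iter G B t (h ↑ˡ L) → h ∈ blueH S t
    Far t = ∀ {v} → 7 ≤ toℕ v → Iter G B t v → ∃ λ s → s + toℕ v ≤ t + 7 × c ∈ blueH S s

    core⇒far : ∀ t {h} → h ∈ blueH S t → 7 ≤ toℕ (h ↑ˡ L) → ∃ λ s → s + toℕ (h ↑ˡ L) ≤ t + 7 × c ∈ blueH S s
    core⇒far t {h} h∈ 7≤ = t , +-monoʳ-≤ t (s≤s⁻¹ (left-<8 h)) , subst (_∈ blueH S t) (left-7⇒c 7≤) h∈

    track : ∀ t → Core t × Far t
    track zero = ∈-++ˡ⁻ , far
      where
      far : Far 0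
      far {v} 7≤ i with split 8 v
      ... | left h = core⇒far 0 (∈-++ˡ⁻ i) 7≤
      ... | right j = ⊥-elim (Q-empty j (∈-++ʳ⁻ S i))
    track (suc t) with track t
    ... | coreₜ , farₜ = core , far
      where
      core : Core (suc t)
      core (inj₁ i) = blue-mono H S t (coreₜ i)
      core {h} (inj₂ (u , f@(bu , _ , e , _))) with split 8 u
      ... | left u′ = core-force coreₜ f
      ... | right j with tail-core-adj {j} {h} e
      ...   | refl , u≡8 with farₜ (<⇒≤ (right-≥8 j)) bu
      -- A force from 8 back to c comes too late, since 8 owes its colour to c.
      ...     | s , le , c∈ = blue-chain H S s (suc t) s≤ c∈
        where
        s≤ : s ≤ suc t
        s≤ = +-cancelʳ-≤ 8 _ _ (≤-trans (subst (λ z → s + z ≤ t + 7) u≡8 le)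
               (≤-trans (+-monoʳ-≤ t (n≤1+n 7)) (n≤1+n _)))
      far : Far (suc t)
      far {v} 7≤ i with split 8 v
      ... | left h = core⇒far (suc t) (core i) 7≤
      far 7≤ (inj₁ i) | right j with farₜ 7≤ i
      ... | s , le , c∈ = s , m≤n⇒m≤1+n le , c∈
      far 7≤ (inj₂ (u , bu , _ , e , _)) | right j with tail-adj {u} {8 ↑ʳ j} (right-≥8 j) e
      ... | 7≤u , v≤ , _ with farₜ 7≤u bu
      ...   | s , le , c∈ = s , ≤-trans (+-monoʳ-≤ s v≤) (≤-trans (≤-reflexive (+-suc s _)) (s≤s le)) , c∈

    slow : ∣ S ∣ ≡ 3 → ∀ {T} → AllBlue G B T → L + 5 ≤ T + T
    slow ∣S∣≡3 {T} a with proj₂ (track T) {last} (subst (7 ≤_) (sym (toℕ-fromℕ (7 + L))) (m≤m+n 7 L)) (a last)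
    ... | s , le , c∈ = begin
      L + 5         ≤⟨ +-monoʳ-≤ L 5≤ ⟩
      L + (s + T)   ≡⟨ eq L s T ⟩
      (s + L) + T   ≤⟨ +-monoˡ-≤ T s+L≤T ⟩
      T + T         ∎
      where
      open ≤-Reasoning
      eq : ∀ L s T → L + (s + T) ≡ (s + L) + T
      eq = solve-∀
      s+L≤T : s + L ≤ T
      s+L≤T = +-cancelʳ-≤ 7 _ _ (subst (_≤ T + 7) (trans (cong (s +_) (trans (toℕ-fromℕ (7 + L)) (+-comm 7 L))) (sym (+-assoc s L 7))) le)
      full : ∀ t → T ≤ t → Full (blueH S t)
      full t T≤t x = blue-chain H S T t T≤t (proj₁ (track T) (a (x ↑ˡ L)))
      case : ∀ s → s ≤ T → c ∈ blueH S s → 5 ≤ s + T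
      case 0 _ c∈ = ≰⇒> λ T≤4 → no-fast₃ (S , ∣S∣≡3 , inj₁ (c∈ , full 4 T≤4))
      case 1 _ c∈ = s≤s (≰⇒> λ T≤3 → no-fast₃ (S , ∣S∣≡3 , inj₂ (inj₁ (c∈ , full 3 T≤3))))
      case 2 _ c∈ = s≤s (s≤s (≰⇒> λ T≤2 → no-fast₃ (S , ∣S∣≡3 , inj₂ (inj₂ (c∈ , full 2 T≤2)))))
      -- From s ≥ 3 on, T ≥ s makes the sum at least 6.
      case (suc (suc (suc s))) s≤T _ = ≤-trans (n≤1+n 5)
        (+-mono-≤ (m≤m+n 3 s) (≤-trans (m≤m+n 3 s) s≤T))
      5≤ : 5 ≤ s + T
      5≤ = case s (≤-trans (m≤m+n s L) s+L≤T) c∈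

  module WithTail (S : Subset 8) (Q : Subset L) where

    B = S ++ Q

    -- The path acts on the core only by colouring c, so granting c at the start bounds the core
    -- from above.
    S⁺ : Subset 8
    S⁺ = S ∪ ⁅ c ⁆

    c∈S⁺ : c ∈ S⁺
    c∈S⁺ = x∈p∪q⁺ (inj₂ (x∈⁅x⁆ c))

    S⊆S⁺ : S ⊆ S⁺
    S⊆S⁺ = p⊆p∪q ⁅ c ⁆

    core⁺ : ∀ t {h} → Iter G B t (h ↑ˡ L) → h ∈ blueH S⁺ t
    core⁺ zero i = S⊆S⁺ (∈-++ˡ⁻ i)
    core⁺ (suc t) (inj₁ i) = blue-mono H S⁺ t (core⁺ t i)
    core⁺ (suc t) {h} (inj₂ (u , f@(_ , _ , e , _))) with split 8 u
    ... | left u′ = core-force (core⁺ t) f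
    ... | right j with tail-core-adj {j} {h} e
    ...   | refl , _ = start⊆blue H S⁺ (suc t) c∈S⁺

    module _ (c∉S : c ∉ S) (closed : next H S ⊆ S) (i : Fin L) (Q≡i : ∀ {j} → j ∈ Q → j ≡ i) where

      -- The distance from c = 7 to 8 + i, the only possible starting vertex on the path.
      ι : ℕ
      ι = suc (toℕ i)

      -- Before time ι only S is blue in the core; afterwards the core lags at least ι steps behind
      -- the process from `S⁺`. `Near` and `Far` let blue advance along the path by at most one
      -- vertex per step in either direction.
      Core Near Far : ℕ → Set
      Core t = ∀ {h} → Iter G B t (h ↑ˡ L) → h ∈ S ⊎ ∃ λ s → s + ι ≤ t × h ∈ blueH S⁺ s
      Near t = ∀ {v} → 7 ≤ toℕ v → Iter G B t v → ι + 7 ≤ toℕ v + t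
      Far t = ∀ {v} → Iter G B t v → toℕ v ≤ 7 + ι + t

      core⇒near : ∀ t → Core t → ∀ {h} → 7 ≤ toℕ (h ↑ˡ L) → Iter G B t (h ↑ˡ L) → ι + 7 ≤ toℕ (h ↑ˡ L) + t
      core⇒near t core 7≤ b with core b
      ... | inj₁ h∈S = ⊥-elim (c∉S (subst (_∈ S) (left-7⇒c 7≤) h∈S))
      ... | inj₂ (s , s+ι≤t , _) = ≤-trans (≤-reflexive (+-comm ι 7)) (+-mono-≤ 7≤ (≤-trans (m≤n+m ι s) s+ι≤t))

      tail-start : ∀ {j} → 8 ↑ʳ j ∈ B → toℕ (8 ↑ʳ j) ≡ 7 + ι
      tail-start b = trans (cong (λ j → toℕ (8 ↑ʳ j)) (Q≡i (∈-++ʳ⁻ S b))) (toℕ-↑ʳ 8 i)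

      track : ∀ t → Core t × Near t × Far t
      track zero = core , near , far
        where
        core : Core 0
        core b = inj₁ (∈-++ˡ⁻ b)
        near : Near 0
        near {v} 7≤ b with split 8 v
        ... | left h = core⇒near 0 core 7≤ b
        ... | right j = ≤-reflexive (trans (+-comm ι 7) (trans (sym (tail-start b)) (sym (+-identityʳ _))))
        far : Far 0
        far {v} b with split 8 v
        ... | left h = ≤-trans (<⇒≤ (left-<8 h)) (m≤m+n 8 _)
        ... | right j = ≤-reflexive (trans (tail-start b) (sym (+-identityʳ _)))
      track (suc t) with track t
      ... | coreₜ , nearₜ , farₜ = core , near , far
        where
        core : Core (suc t)
        core (inj₁ b) with coreₜ b
        ... | inj₁ h∈S = inj₁ h∈S
        ... | inj₂ (s , le , h∈) = inj₂ (s , m≤n⇒m≤1+n le , h∈)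
        core {h} (inj₂ (u , f@(bu , _ , e , _))) with split 8 u
        ... | right j with tail-core-adj {j} {h} e
        -- c is reached along the path at time ι at the earliest, which is time 0 of the process
        -- from `S⁺`.
        ...   | refl , u≡8 = inj₂ (0 , +-cancelʳ-≤ 7 _ _ (≤-trans (subst (λ z → ι + 7 ≤ z + t) u≡8 (nearₜ (<⇒≤ (right-≥8 j)) bu))
                  (≤-reflexive (cong suc (+-comm 7 t)))) , c∈S⁺)
        core {h} (inj₂ (u , f)) | left u′ with ι ≤? t
        ... | no ι≰t = inj₁ (closed (core-force only-S f))
          where
          only-S : ∀ {h} → Iter G B t (h ↑ˡ L) → h ∈ S
          only-S b with coreₜ b
          ... | inj₁ h∈S = h∈S
          ... | inj₂ (s , le , _) = ⊥-elim (ι≰t (≤-trans (m≤n+m ι s) le))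
        ... | yes ι≤t = inj₂ (suc (t ∸ ι) , s≤s (≤-reflexive (m∸n+n≡m ι≤t)) , core-force delayed f)
          where
          delayed : ∀ {h} → Iter G B t (h ↑ˡ L) → h ∈ blueH S⁺ (t ∸ ι)
          delayed b with coreₜ b
          ... | inj₁ h∈S = start⊆blue H S⁺ (t ∸ ι) (S⊆S⁺ h∈S)
          ... | inj₂ (s , le , h∈) = blue-chain H S⁺ s (t ∸ ι) (≤-trans (≤-reflexive (sym (m+n∸n≡m s ι))) (∸-monoˡ-≤ ι le)) h∈
        near : Near (suc t)
        near {v} 7≤ b with split 8 v
        ... | left h = core⇒near (suc t) core 7≤ b
        near 7≤ (inj₁ b) | right j = ≤-trans (nearₜ 7≤ b) (+-monoʳ-≤ (toℕ (8 ↑ʳ j)) (n≤1+n t))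
        near 7≤ (inj₂ (u , bu , _ , e , _)) | right j with tail-adj {u} {8 ↑ʳ j} (right-≥8 j) e
        ... | 7≤u , _ , u≤ = ≤-trans (nearₜ 7≤u bu) (≤-trans (+-monoˡ-≤ t u≤) (≤-reflexive (sym (+-suc _ t))))
        far : Far (suc t)
        far (inj₁ b) = ≤-trans (farₜ b) (+-monoʳ-≤ (7 + ι) (n≤1+n t))
        far {v} (inj₂ (u , bu , _ , e , _)) with split 8 v
        ... | left h = ≤-trans (<⇒≤ (left-<8 h)) (m≤m+n 8 _)
        ... | right j = ≤-trans (proj₁ (proj₂ (tail-adj {u} {8 ↑ʳ j} (right-≥8 j) e)))
                (≤-trans (s≤s (farₜ bu)) (≤-reflexive (sym (+-suc (7 + ι) t))))

      -- The core needs time at least ι + 5 and the end of the path at least L - ι; adding the two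
      -- bounds eliminates ι.
      slow : ¬ Full (blueH S⁺ 4) → ∀ {T} → AllBlue G B T → L + 5 ≤ T + T
      slow ¬full {T} a with ¬∀⟶∃¬ 8 _ (_∈? blueH S⁺ 4) ¬full
      ... | h , h∉ with proj₁ (track T) (a (h ↑ˡ L))
      ...   | inj₁ h∈S = ⊥-elim (h∉ (start⊆blue H S⁺ 4 (S⊆S⁺ h∈S)))
      ...   | inj₂ (s , s+ι≤T , h∈) = begin
        L + 5         ≤⟨ +-monoˡ-≤ 5 L≤ ⟩
        ι + T + 5     ≡⟨ eq ι T ⟩
        5 + ι + T     ≤⟨ +-monoˡ-≤ T (≤-trans (+-monoˡ-≤ ι 5≤s) s+ι≤T) ⟩
        T + T         ∎
        where
        open ≤-Reasoning
        eq : ∀ i T → i + T + 5 ≡ 5 + i + T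
        eq = solve-∀
        5≤s : 5 ≤ s
        5≤s = ≰⇒> λ s≤4 → h∉ (blue-chain H S⁺ s 4 s≤4 h∈)
        L≤ : L ≤ ι + T
        L≤ = +-cancelˡ-≤ 7 _ _ (subst (_≤ 7 + ι + T) (toℕ-fromℕ (7 + L)) (proj₂ (proj₂ (track T)) (a last)))

    -- A non-empty `Q` leaves |S| ≤ 2, and `S⁺` forces H. By the finite check S is then slow with
    -- |S| = 2, so `Q` is a single vertex.
    all-slow : ∣ S ∣ + ∣ Q ∣ ≡ 3 → ∃ (_∈ Q) → ∀ {T} → AllBlue G B T → L + 5 ≤ T + T
    all-slow ∣S∣+∣Q∣≡3 (i , i∈Q) {T} a = decidable-stable (L + 5 ≤? T + T)
      λ ¬goal → no-fast₂ (S , ∣S∣≤2 , full , λ (∣S∣≡2 , c∉S , closed , ¬full₄) →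
        ¬goal (slow c∉S closed i (λ j∈ → ∣p∣≤1⇒≡ Q (∣Q∣≤1 ∣S∣≡2) i∈Q j∈) ¬full₄ {T} a))
      where
      0<∣Q∣ : 0 < ∣ Q ∣
      0<∣Q∣ = ≤-trans (s≤s z≤n) (x∈p⇒∣p-x∣<∣p∣ i∈Q)
      ∣S∣≤2 : ∣ S ∣ ≤ 2
      ∣S∣≤2 = +-cancelʳ-≤ 1 _ _ (≤-trans (+-monoʳ-≤ ∣ S ∣ 0<∣Q∣) (≤-reflexive ∣S∣+∣Q∣≡3))
      ∣Q∣≤1 : ∣ S ∣ ≡ 2 → ∣ Q ∣ ≤ 1
      ∣Q∣≤1 ∣S∣≡2 = +-cancelˡ-≤ 2 _ _ (≤-reflexive (trans (cong (_+ ∣ Q ∣) (sym ∣S∣≡2)) ∣S∣+∣Q∣≡3))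
      full : Full (blueH S⁺ 8)
      full x = Iter⇒blue H S⁺ 8 (AllBlue-n H S⁺ (T , λ y → blue⇒Iter H S⁺ T (core⁺ T (a (y ↑ˡ L)))) x)

  slow : ∀ B → ∣ B ∣ ≡ 3 → ∀ {T} → AllBlue G B T → L + 5 ≤ T + T
  slow B ∣B∣≡3 {T} a with Vec.splitAt 8 B
  ... | S , Q , refl with nonempty? Q
  ...   | yes ne = WithTail.all-slow S Q (trans (sym (∣p++q∣ S Q)) ∣B∣≡3) ne {T} a
  ...   | no empty = NoTail.slow S Q (λ j j∈ → empty (j , j∈))
            (trans (sym (trans (∣p++q∣ S Q) (trans (cong (∣ S ∣ +_) (trans (cong ∣_∣ (Empty-unique empty)) (∣⊥∣≡0 L))) (+-identityʳ _)))) ∣B∣≡3) {T} a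

-- Propagation time of the complements

module CoTail (L : ℕ) where
  open Tail L

  Ḡ : Graph (8 + L)
  Ḡ = complement G

  adj-cocore : ∀ a b → adj (complement H) a b ≡ adj Ḡ (a ↑ˡ L) (b ↑ˡ L)
  adj-cocore a b = trans (adj-colink a b)
    (trans (sym (cong₂ colink (toℕ-↑ˡ a L) (toℕ-↑ˡ b L))) (sym (adj-colink (a ↑ˡ L) (b ↑ˡ L))))

  Collapse : Fin (8 + L) → Fin 10 → Set
  Collapse v v′ = toℕ v′ ≡ toℕ v ⊓ 9

  collapse : ∀ v → ∃ (Collapse v)
  collapse v = fromℕ< (s≤s (m⊓n≤n (toℕ v) 9)) , toℕ-fromℕ< _

  collapse-left : ∀ {v v′} → Collapse v v′ → toℕ v′ < 8 → ∃ λ h → v ≡ h ↑ˡ L × v′ ≡ h ↑ˡ 2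
  collapse-left {v} {v′} r v′<8 with split 8 v
  ... | left h = h , refl , toℕ-injective (trans r (trans (cong (_⊓ 9) (toℕ-↑ˡ h L))
        (trans (m≤n⇒m⊓n≡m (≤-trans (<⇒≤ (toℕ<n h)) (n≤1+n 8))) (sym (toℕ-↑ˡ h 2)))))
  ... | right j = ⊥-elim (<⇒≱ v′<8 (subst (8 ≤_) (sym r) (⊓-glb (right-≥8 j) (n≤1+n 8))))

  left-collapse : ∀ h → Collapse (h ↑ˡ L) (h ↑ˡ 2)
  left-collapse h = trans (toℕ-↑ˡ h 2) (sym (trans (cong (_⊓ 9) (toℕ-↑ˡ h L))
    (m≤n⇒m⊓n≡m (≤-trans (<⇒≤ (toℕ<n h)) (n≤1+n 8)))))

  adj-collapse : ∀ {a a′ b b′} → Collapse a a′ → Collapse b b′ → toℕ b′ < 8 → adj Ḡ a b ≡ adj H̄⁺ a′ b′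
  adj-collapse {a} {a′} {b} {b′} ra rb b′<8 with collapse-left rb b′<8
  ... | h , refl , refl = begin
    adj Ḡ a (h ↑ˡ L)                          ≡⟨ adj-colink a (h ↑ˡ L) ⟩
    colink (toℕ a) (toℕ (h ↑ˡ L))             ≡⟨ colink-⊓9 (toℕ a) _ (left-<8 h) ⟨
    colink (toℕ a ⊓ 9) (toℕ (h ↑ˡ L))         ≡⟨ cong₂ colink (sym ra) (trans (toℕ-↑ˡ h L) (sym (toℕ-↑ˡ h 2))) ⟩
    colink (toℕ a′) (toℕ (h ↑ˡ 2))            ≡⟨ adj-colink a′ (h ↑ˡ 2) ⟨
    adj H̄⁺ a′ (h ↑ˡ 2)                        ∎
    where open ≡-Reasoning

  -- While the white vertices are among the first eight, forces survive the collapse.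
  collapse-force : {B : VSet (8 + L)} {A : Subset 10} → (∀ {v v′} → Collapse v v′ → B v → v′ ∈ A) →
    (∀ {v′} → 8 ≤ toℕ v′ → v′ ∈ A) → ∀ {w w′} → Collapse w w′ → CanForce Ḡ B w → w′ ∈ next H̄⁺ A
  collapse-force {B} {A} sub tail {w} {w′} rw (u , f@(bu , _)) with w′ ∈? A
  ... | yes w′∈ = next⁺ H̄⁺ (inj₁ w′∈)
  ... | no w′∉ = next⁺ H̄⁺ (inj₂ (u′ , Simulation.forces-sim {G = Ḡ} {H̄⁺} {B} {_∈ A} Collapse white
      (λ ra rb ¬b → adj-collapse ra rb (core ¬b)) ru (sub ru bu) rw w′∉
      (λ rx _ → toℕ-injective (trans rx (sym rw))) f))
    where
    u′ = proj₁ (collapse u)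
    ru = proj₂ (collapse u)
    core : ∀ {v′} → v′ ∉ A → toℕ v′ < 8
    core v′∉ = ≰⇒> (λ 8≤ → v′∉ (tail 8≤))
    white : ∀ {x′} → x′ ∉ A → ∃ λ x → Collapse x x′ × ¬ B x
    white {x′} x′∉ with split 8 x′
    ... | left h = h ↑ˡ L , left-collapse h , x′∉ ∘ sub (left-collapse h)
    ... | right j = ⊥-elim (x′∉ (tail (subst (8 ≤_) (sym (toℕ-↑ʳ 8 j)) (m≤m+n 8 _))))

  pad-tail : ∀ S {v′} → 8 ≤ toℕ v′ → v′ ∈ pad S
  pad-tail S {v′} 8≤ with split 8 v′
  ... | left h = ⊥-elim (<⇒≱ (subst (_< 8) (sym (toℕ-↑ˡ h 2)) (toℕ<n h)) 8≤)
  ... | right zero = ∈-++ʳ⁺ S here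
  ... | right (suc zero) = ∈-++ʳ⁺ S (there here)

  pad-collapse : ∀ S Q {v v′} → Collapse v v′ → v ∈ S ++ Q → v′ ∈ pad S
  pad-collapse S Q {v} {v′} r v∈ with toℕ v′ <? 8
  ... | no ≮8 = pad-tail S (≮⇒≥ ≮8)
  ... | yes <8 with collapse-left r <8
  ...   | h , refl , refl = ∈-++ˡ⁺ {p = S} (∈-++ˡ⁻ {p = S} v∈)

  full-pad : ∀ {A : Subset 10} → (∀ {v′} → 8 ≤ toℕ v′ → v′ ∈ A) → (∀ h → h ↑ˡ 2 ∈ A) → Full A
  full-pad tail core v′ with split 8 v′
  ... | left h = core h
  ... | right j = tail (subst (8 ≤_) (sym (toℕ-↑ʳ 8 j)) (m≤m+n 8 _))

  -- Counting the whole path as blue only helps, so two steps in Ḡ would give two steps in the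
  -- collapsed graph.
  core-slow : ∀ S Q → ∣ S ∣ ≡ 3 → ¬ AllBlue Ḡ (S ++ Q) 2
  core-slow S Q ∣S∣≡3 a = no-cofast₅ (S , ∣S∣≡3 , full-pad (tail 2) (λ h → track 2 (left-collapse h) (a (h ↑ˡ L))))
    where
    tail : ∀ t {v′} → 8 ≤ toℕ v′ → v′ ∈ blue H̄⁺ (pad S) t
    tail t 8≤ = start⊆blue H̄⁺ (pad S) t (pad-tail S 8≤)
    track : ∀ t {v v′} → Collapse v v′ → Iter Ḡ (S ++ Q) t v → v′ ∈ blue H̄⁺ (pad S) t
    track zero r i = pad-collapse S Q r i
    track (suc t) r (inj₁ i) = blue-mono H̄⁺ (pad S) t (track t r i)
    track (suc t) r (inj₂ f) = collapse-force (track t) (tail t) r f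

  coadj-false : ∀ {x y} → x ≢ y → adj Ḡ x y ≢ true → adj G x y ≡ true
  coadj-false {x} {y} x≢y ¬e = decidable-stable (adj G x y Bool.≟ true)
    (λ ¬a → ¬e (complement-adj {G = G} x≢y (Bool.¬-not ¬a)))

  degree≤3 : ∀ {a} → 7 ≤ toℕ a → (P : Subset (8 + L)) → (∀ {y} → y ∈ P → adj G a y ≡ true) → ∣ P ∣ ≤ 3
  degree≤3 {a} 7≤a P nb = ∣p∣≤length P (suc (toℕ a) ∷ toℕ a ∸ 1 ∷ 1 ∷ []) member
    where
    member : ∀ {y} → y ∈ P → toℕ y List.∈ _
    member {y} y∈ with link-tail (toℕ a) (toℕ y) 7≤a (nb y∈)
    ... | inj₁ eq = here eq
    ... | inj₂ (inj₁ eq) = there (here (cong (_∸ 1) (sym eq)))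
    ... | inj₂ (inj₂ (_ , eq)) = there (there (here eq))

  degree≤2 : ∀ {a} → 8 ≤ toℕ a → (P : Subset (8 + L)) → (∀ {y} → y ∈ P → adj G a y ≡ true) → ∣ P ∣ ≤ 2
  degree≤2 {a} 8≤a P nb = ∣p∣≤length P (suc (toℕ a) ∷ toℕ a ∸ 1 ∷ []) member
    where
    member : ∀ {y} → y ∈ P → toℕ y List.∈ _
    member {y} y∈ with link-far (toℕ a) (toℕ y) 8≤a (nb y∈)
    ... | inj₁ eq = here eq
    ... | inj₂ eq = there (here (cong (_∸ 1) (sym eq)))

  -- If C also met the path, both sides would have at most two vertices by `degree≤2`. Otherwise C
  -- is at most the vertex 7, and K has at most three vertices. Neither gives five.
  no-join : (C K : Subset (8 + L)) → (∀ {y z} → y ∈ C → z ∈ K → adj G y z ≡ true) → 5 ≤ ∣ C ∣ + ∣ K ∣ →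
    ∀ {x w} → 8 ≤ toℕ x → x ∈ K → w ∉ C
  no-join C K join 5≤ {x} {w} 8≤x x∈K w∈C = contra (any? (λ y → y ∈? C ×-dec 8 ≤? toℕ y))
    where
    adj-x : ∀ {y} → y ∈ C → adj G x y ≡ true
    adj-x {y} y∈ = adj-sym-true {G = G} {y} {x} (join y∈ x∈K)
    contra : ¬ Dec (∃ λ y → y ∈ C × 8 ≤ toℕ y)
    contra (yes (y , y∈ , 8≤y)) = 1+n≰n (≤-trans 5≤ (+-mono-≤ (degree≤2 8≤x C adj-x) (degree≤2 8≤y K (join y∈))))
    contra (no none) = 1+n≰n (≤-trans 5≤ (+-mono-≤ {∣ C ∣} {1} (∣p∣≤length C (7 ∷ []) only7)
      (degree≤3 (proj₁ (tail-adj {w} {x} 8≤x (join w∈C x∈K))) K (join w∈C))))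
      where
      only7 : ∀ {y} → y ∈ C → toℕ y List.∈ 7 ∷ []
      only7 {y} y∈ = here (≤-antisym (≮⇒≥ (λ 8≤y → none (y , y∈ , 8≤y))) (proj₁ (tail-adj {y} {x} 8≤x (join y∈ x∈K))))

  -- A white vertex x outside the first eight makes the white vertices connected in the complement,
  -- and only a vertex adjacent in G to all of them but x can force anything.
  forced-far : (B : Subset (8 + L)) → ∣ B ∣ ≡ 3 + L → ∀ {x} → 8 ≤ toℕ x → x ∉ B → ∀ {u w} → Forces Ḡ (_∈ B) u w →
    w ≡ x × toℕ u < 7 × (∀ {y} → y ∉ B → y ≢ x → adj G u y ≡ true)
  forced-far B ∣B∣≡ {x} 8≤x x∉B {u} {w} (u∈ , w∉ , e , unique) = w≡x , u<7 , λ y∉ y≢x → adj-u (white⇒C y∉) (λ eq → y≢x (trans eq w≡x))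
    where
    C : Subset (8 + L)
    C = Reach.component Ḡ (_∈? B) w
    sound : ∀ {y} → y ∈ C → Conn Ḡ (_∈ B) w y
    sound = Reach.component-sound Ḡ (_∈? B) w
    complete : ∀ {y} → Conn Ḡ (_∈ B) w y → y ∈ C
    complete = Reach.component-complete Ḡ (_∈? B) w
    -- The white vertices outside the component of w in Ḡ; in G they are adjacent to all of that
    -- component.
    K : Subset (8 + L)
    K = ∁ (B ∪ C)
    K⇒∉B : ∀ {z} → z ∈ K → z ∉ B
    K⇒∉B z∈ z∈B = x∈∁p⇒x∉p z∈ (x∈p∪q⁺ (inj₁ z∈B))
    K⇒∉C : ∀ {z} → z ∈ K → z ∉ C
    K⇒∉C z∈ z∈C = x∈∁p⇒x∉p z∈ (x∈p∪q⁺ (inj₂ z∈C))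
    join : ∀ {y z} → y ∈ C → z ∈ K → adj G y z ≡ true
    join {y} {z} y∈ z∈ = coadj-false {y} {z} (λ { refl → K⇒∉C z∈ y∈ })
      (λ e′ → K⇒∉C z∈ (complete (conn-snoc (sound y∈) e′ (K⇒∉B z∈))))
    five : ∣ C ∣ + ∣ K ∣ ≡ 5
    five = +-cancelˡ-≡ (3 + L) _ _ (begin
      3 + L + (∣ C ∣ + ∣ K ∣)           ≡⟨ +-assoc (3 + L) ∣ C ∣ ∣ K ∣ ⟨
      3 + L + ∣ C ∣ + ∣ K ∣             ≡⟨ cong (λ b → b + ∣ C ∣ + ∣ K ∣) ∣B∣≡ ⟨
      ∣ B ∣ + ∣ C ∣ + ∣ K ∣             ≡⟨ cong (_+ ∣ K ∣) (disjoint⇒∣p∣+∣q∣≡∣p∪q∣ B C (λ b c → conn-target (sound c) b)) ⟩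
      ∣ B ∪ C ∣ + ∣ K ∣                 ≡⟨ cong (∣ B ∪ C ∣ +_) (∣∁p∣≡n∸∣p∣ (B ∪ C)) ⟩
      ∣ B ∪ C ∣ + (8 + L ∸ ∣ B ∪ C ∣)   ≡⟨ m+[n∸m]≡n (∣p∣≤n (B ∪ C)) ⟩
      8 + L                             ≡⟨ eq L ⟩
      3 + L + 5                         ∎)
      where
      open ≡-Reasoning
      eq : ∀ L → 8 + L ≡ 3 + L + 5
      eq = solve-∀
    w∈C : w ∈ C
    w∈C = complete (here w∉)
    x∈C : x ∈ C
    x∈C = decidable-stable (x ∈? C) λ x∉C → no-join C K join (≤-reflexive (sym five)) 8≤x
      (x∉p⇒x∈∁p (λ x∈ → case x∉C (x∈p∪q⁻ B C x∈))) w∈C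
      where
      case : x ∉ C → ¬ (x ∈ B ⊎ x ∈ C)
      case x∉C (inj₁ b) = x∉B b
      case x∉C (inj₂ c) = x∉C c
    K-empty : ∀ {z} → z ∉ K
    K-empty = no-join K C (λ {z} {y} z∈ y∈ → adj-sym-true {G = G} {y} {z} (join y∈ z∈))
      (≤-reflexive (trans (sym five) (+-comm ∣ C ∣ ∣ K ∣))) 8≤x x∈C
    white⇒C : ∀ {y} → y ∉ B → y ∈ C
    white⇒C {y} y∉ with x∈p∪q⁻ B C (x∉∁p⇒x∈p {x = y} {p = B ∪ C} K-empty)
    ... | inj₁ b = ⊥-elim (y∉ b)
    ... | inj₂ c = c
    adj-u : ∀ {y} → y ∈ C → y ≢ w → adj G u y ≡ true
    adj-u {y} y∈ y≢w = coadj-false {u} {y} (λ { refl → conn-target (sound y∈) u∈ })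
      (λ e′ → y≢w (unique y (conn-target (sound y∈)) e′ (sound y∈)))
    4≤ : 4 ≤ ∣ C - w ∣
    4≤ = s≤s⁻¹ (≤-trans (≤-reflexive (sym ∣C∣≡5)) (∣p∣≤1+∣p-x∣ C w))
      where
      ∣C∣≡5 : ∣ C ∣ ≡ 5
      ∣C∣≡5 = trans (sym (trans (cong (∣ C ∣ +_) (trans (cong ∣_∣ (Empty-unique (λ (z , z∈) → K-empty z∈))) (∣⊥∣≡0 (8 + L)))) (+-identityʳ _))) five
    -- In G the forcer u is adjacent to the four white vertices other than w, while vertices from 7
    -- on have degree at most 3.
    u<7 : toℕ u < 7
    u<7 = ≰⇒> λ 7≤u → 1+n≰n (≤-trans 4≤ (degree≤3 7≤u (C - w)
      (λ y∈ → adj-u (p─q⊆p C ⁅ w ⁆ y∈) (λ { refl → x∉p-x C w y∈ }))))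
    -- Otherwise u would be adjacent in G to x, although vertices below 7 have no neighbour on the
    -- path.
    w≡x : w ≡ x
    w≡x = decidable-stable (w ≟ x) λ w≢x → <⇒≱ (link-core (toℕ u) (toℕ x) u<7 (adj-u x∈C (w≢x ∘ sym))) 8≤x

  module FarWhite (S : Subset 8) (Q : Subset L) (∣B∣≡ : ∣ S ++ Q ∣ ≡ 3 + L) (j : Fin L) (j∉Q : j ∉ Q) where

    B : Subset (8 + L)
    B = S ++ Q

    x : Fin (8 + L)
    x = 8 ↑ʳ j

    x∉B : x ∉ B
    x∉B x∈ = j∉Q (∈-++ʳ⁻ S x∈)

    far : ∀ {u w} → Forces Ḡ (_∈ B) u w → w ≡ x × toℕ u < 7 × (∀ {y} → y ∉ B → y ≢ x → adj G u y ≡ true)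
    far = forced-far B ∣B∣≡ (right-≥8 j) x∉B

    -- Every force available at the start has target x, so without one the first step changes
    -- nothing and neither does the second.
    stuck : ¬ CanForce Ḡ (_∈ B) x → ¬ Iter Ḡ B 2 x
    stuck ¬f = second
      where
      first : ∀ {v} → Iter Ḡ B 1 v → v ∈ B
      first (inj₁ b) = b
      first (inj₂ (u , f)) = ⊥-elim (¬f (u , subst (Forces Ḡ (_∈ B) u) (proj₁ (far f)) f))
      second : ¬ Iter Ḡ B 2 x
      second (inj₁ i) = x∉B (first i)
      second (inj₂ (u , f)) = ¬f (u , forces-mono first x∉B f)

    -- The first step colours at most x, which the collapse counts as blue already.
    first : ∀ {v v′} → Collapse v v′ → Iter Ḡ B 1 v → v′ ∈ pad S
    first r (inj₁ b) = pad-collapse S Q r b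
    first {v} {v′} r (inj₂ (_ , f)) = pad-tail S (subst (8 ≤_) (sym r)
      (⊓-glb (subst (λ z → 8 ≤ toℕ z) (sym (proj₁ (far f))) (right-≥8 j)) (n≤1+n 8)))

    second : ∀ {v v′} → Collapse v v′ → Iter Ḡ B 2 v → v′ ∈ next H̄⁺ (pad S)
    second r (inj₁ i) = next⁺ H̄⁺ (inj₁ (first r i))
    second r (inj₂ f) = collapse-force first (pad-tail S) r f

    module _ {u : Fin (8 + L)} (u<7 : toℕ u < 7) (star : ∀ {y} → y ∉ B → y ≢ x → adj G u y ≡ true) where

      -- In G the vertex u has no neighbour on the path, so x is the only white vertex there.
      others : ∀ j′ → j′ ∈ Q ∪ ⁅ j ⁆
      others j′ with j′ ∈? Q | j′ ≟ j
      ... | yes j′∈ | _ = x∈p∪q⁺ (inj₁ j′∈)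
      ... | no _ | yes refl = x∈p∪q⁺ (inj₂ (x∈⁅x⁆ j))
      ... | no j′∉ | no j′≢ = ⊥-elim (<⇒≱ (link-core (toℕ u) (toℕ (8 ↑ʳ j′)) u<7
              (star {8 ↑ʳ j′} (j′∉ ∘ ∈-++ʳ⁻ S) (λ eq → j′≢ (↑ʳ-injective 8 j′ j eq)))) (right-≥8 j′))

      ∣S∣≡4 : ∣ S ∣ ≡ 4
      ∣S∣≡4 = +-cancelʳ-≡ ∣ Q ∣ _ _ (trans (sym (∣p++q∣ S Q)) (trans ∣B∣≡
        (cong (3 +_) (sym (trans (1+∣p∣≡∣p∪⁅x⁆∣ Q j∉Q) (full⇒∣p∣≡n others))))))

    star-core : ∀ u′ → (∀ {y} → y ∉ B → y ≢ x → adj G (u′ ↑ˡ L) y ≡ true) → ∀ h → h ∉ S → adj H u′ h ≡ true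
    star-core u′ star h h∉ = trans (sym (adj-core u′ h)) (star {h ↑ˡ L} (λ h∈ → h∉ (∈-++ˡ⁻ {p = S} h∈))
      (λ eq → <⇒≱ (left-<8 h) (subst (λ z → 8 ≤ toℕ z) (sym eq) (right-≥8 j))))

    star-slow : ∀ u → toℕ u < 7 → (∀ {y} → y ∉ B → y ≢ x → adj G u y ≡ true) → ¬ AllBlue Ḡ B 2
    star-slow u u<7 star a with split 8 u
    ... | right j′ = <⇒≱ u<7 (<⇒≤ (right-≥8 j′))
    ... | left u′ = no-cofast₄ (S , ∣S∣≡4 u<7 star , (u′ , star-core u′ star) ,
            full-pad (λ 8≤ → next⁺ H̄⁺ (inj₁ (pad-tail S 8≤))) (λ h → second (left-collapse h) (a (h ↑ˡ L))))

    not-in-two-steps : ¬ AllBlue Ḡ B 2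
    not-in-two-steps a with canForce? Ḡ (_∈? B) x
    ... | no ¬f = stuck ¬f (a x)
    ... | yes (u , f) = star-slow u (proj₁ (proj₂ (far f))) (proj₂ (proj₂ (far f))) a

  coslow : ∀ B → ∣ B ∣ ≡ 3 + L → ¬ AllBlue Ḡ B 2
  coslow B ∣B∣≡ a with Vec.splitAt 8 B
  ... | S , Q , refl with any? (λ j → ¬? (j ∈? Q))
  ...   | yes (j , j∉) = FarWhite.not-in-two-steps S Q ∣B∣≡ j j∉ a
  ...   | no none = core-slow S Q ∣S∣≡3 a
    where
    ∣S∣≡3 : ∣ S ∣ ≡ 3
    ∣S∣≡3 = +-cancelʳ-≡ L _ _ (trans (cong (∣ S ∣ +_) (sym (full⇒∣p∣≡n {p = Q} (λ j → decidable-stable (j ∈? Q) (λ j∉ → none (j , j∉))))))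
      (trans (sym (∣p++q∣ S Q)) ∣B∣≡))

  hubs : Subset (8 + L)
  hubs = (inside ∷ inside ∷ inside ∷ outside ∷ outside ∷ outside ∷ outside ∷ outside ∷ []) ++ ∅

  ∣hubs∣≡3 : ∣ hubs ∣ ≡ 3
  ∣hubs∣≡3 = cong (3 +_) (∣⊥∣≡0 L)

  -- With both hubs blue only the path is left, and blue advances along it by one vertex per step.
  hubs-spread : ∀ t {v} → toℕ v ≤ 2 + t → Iter G hubs t v
  hubs-spread zero {zero} _ = here
  hubs-spread zero {suc zero} _ = there here
  hubs-spread zero {suc (suc zero)} _ = there (there here)
  hubs-spread zero {suc (suc (suc v))} (s≤s (s≤s ()))
  hubs-spread (suc t) {v} v≤ with Iter? G hubs t v
  ... | yes i = inj₁ i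
  ... | no ¬i = inj₂ (u , hubs-spread t (≤-reflexive u≡) , ¬i , uv , unique)
    where
    v≡ : toℕ v ≡ 3 + t
    v≡ = ≤-antisym (≤-trans v≤ (≤-reflexive (+-suc 2 t))) (≰⇒> (λ le → ¬i (hubs-spread t le)))
    2+t< : 2 + t < 8 + L
    2+t< = <-trans (≤-reflexive (sym v≡)) (toℕ<n v)
    u : Fin (8 + L)
    u = fromℕ< 2+t<
    u≡ : toℕ u ≡ 2 + t
    u≡ = toℕ-fromℕ< 2+t<
    uv : adj G u v ≡ true
    uv = trans (cong₂ link u≡ v≡) (path t)
      where
      path : ∀ t → link (2 + t) (3 + t) ≡ true
      path t = cong (_∨ arc (3 + t) (2 + t)) (≡ᵇ-refl t)
    unique : ∀ x → ¬ Iter G hubs t x → adj G u x ≡ true → Conn G (Iter G hubs t) v x → x ≡ v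
    unique x ¬x e _ = toℕ-injective (trans (only (toℕ x) (≰⇒> (λ le → ¬x (hubs-spread t le)))
        (subst (λ i → link i (toℕ x) ≡ true) u≡ e)) (sym v≡))
      where
      only : ∀ j → 2 + t < j → link (2 + t) j ≡ true → j ≡ 3 + t
      only j lt e with ∨-true {arc (2 + t) j} e
      ... | inj₁ e₁ = sym (≡ᵇ-true e₁)
      only (suc (suc j)) lt e | inj₂ e₂ = ⊥-elim (<⇒≱ lt (≤-trans (n≤1+n _) (≤-reflexive (≡ᵇ-true e₂))))
      only 1 (s≤s ()) e | inj₂ _

  hubs-force : IsPSDForcingSet G hubs
  hubs-force = 8 + L , λ v → hubs-spread (8 + L) (≤-trans (<⇒≤ (toℕ<n v)) (m≤n+m _ 2))

  coseed : Subset (8 + L)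
  coseed = seed ++ ⊤

  ∣coseed∣≡3+L : ∣ coseed ∣ ≡ 3 + L
  ∣coseed∣≡3+L = cong (3 +_) (∣⊤∣≡n L)

  -- The path is blue from the start, so all white vertices lie in the core and the forces of the
  -- complement of H remain valid.
  coseed-spread : ∀ t {h} → h ∈ blue (complement H) seed t → Iter Ḡ coseed t (h ↑ˡ L)
  coseed-spread zero h∈ = ∈-++ˡ⁺ h∈
  coseed-spread (suc t) {h} h∈ with Iter? Ḡ coseed t (h ↑ˡ L) | next⁻ (complement H) h∈
  ... | yes i | _ = inj₁ i
  ... | no _ | inj₁ h∈t = inj₁ (coseed-spread t h∈t)
  ... | no ¬i | inj₂ (u , f@(u∈ , _)) = inj₂ (u ↑ˡ L ,
    Simulation.forces-sim {G = complement H} {Ḡ} {_∈ blue (complement H) seed t} {Iter Ḡ coseed t}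
      (λ a a′ → a′ ≡ a ↑ˡ L) white (λ { {a = a} {b = b} refl refl _ → adj-cocore a b })
      refl (coseed-spread t u∈) refl ¬i (λ eq _ → eq) f)
    where
    white : ∀ {x′} → ¬ Iter Ḡ coseed t x′ → ∃ λ x → x′ ≡ x ↑ˡ L × x ∉ blue (complement H) seed t
    white {x′} ¬x′ with split 8 x′
    ... | left x = x , refl , ¬x′ ∘ coseed-spread t
    ... | right j = ⊥-elim (¬x′ (Iter-mono Ḡ coseed {0} {t} z≤n (∈-++ʳ⁺ seed ∈⊤)))

  coseed-force : IsPSDForcingSet Ḡ coseed
  coseed-force = 3 , all
    where
    all : AllBlue Ḡ coseed 3
    all v with split 8 v
    ... | left h = coseed-spread 3 (seed-forces h)
    ... | right j = Iter-mono Ḡ coseed {0} {3} z≤n (∈-++ʳ⁺ seed ∈⊤)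

-- The two explicit sets give Z₊ ≤ 3 and Z₊ ≤ 3 + L for the complement, and Z₊(G) + Z₊(Ḡ) ≥ n - 2
-- turns both into equalities. The bound 2 pt₊ ≤ n - Z₊ + 1 then meets the lower bounds k + 3 and 3.
family-pt-sum : ∀ k {p q} → IsPt (Gr (8 + 2 * k)) p → IsPt (complement (Gr (8 + 2 * k))) q → p + q ≡ k + 6
family-pt-sum k {p} {q} P@(z , zP@(_ , zmin) , (B , ∣B∣≡z , a , _) , _) Q@(l , zQ@(_ , lmin) , (B̄ , ∣B̄∣≡l , ā , _) , _) =
  trans (cong₂ _+_ (≤-antisym p≤ p≥) (≤-antisym q≤ q≥)) (+-assoc k 3 3)
  where
  L = 2 * k
  open CoTail L
  z≤3 : z ≤ 3
  z≤3 = subst (z ≤_) ∣hubs∣≡3 (zmin hubs hubs-force)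
  l≤3+L : l ≤ 3 + L
  l≤3+L = subst (l ≤_) ∣coseed∣≡3+L (lmin coseed coseed-force)
  n≤ : 8 + L ≤ z + l + 2
  n≤ = n≤Z+Z̄+2 (Gr (8 + L)) zP zQ
  z≡3 : z ≡ 3
  z≡3 = ≤-antisym z≤3 (+-cancelʳ-≤ (5 + L) _ _ (≤-trans n≤
    (≤-trans (+-monoˡ-≤ 2 (+-monoʳ-≤ z l≤3+L)) (≤-reflexive (eq z L)))))
    where
    eq : ∀ z L → z + (3 + L) + 2 ≡ z + (5 + L)
    eq = solve-∀
  l≡3+L : l ≡ 3 + L
  l≡3+L = ≤-antisym l≤3+L (+-cancelʳ-≤ 5 _ _ (≤-trans (≤-reflexive (eq₁ L)) (≤-trans n≤
    (≤-trans (+-monoˡ-≤ 2 (+-monoˡ-≤ l z≤3)) (≤-reflexive (eq₂ l))))))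
    where
    eq₁ : ∀ L → 3 + L + 5 ≡ 8 + L
    eq₁ = solve-∀
    eq₂ : ∀ l → 3 + l + 2 ≡ l + 5
    eq₂ = solve-∀
  p≤ : p ≤ k + 3
  p≤ = *-cancelˡ-≤ 2 (+-cancelʳ-≤ 3 _ _ (≤-trans (subst (λ z → 2 * p + z ≤ 9 + L) z≡3 (2pt+Z≤n+1 (Gr (8 + L)) P)) (≤-reflexive (eq k))))
    where
    eq : ∀ k → 9 + 2 * k ≡ 2 * (k + 3) + 3
    eq = solve-∀
  p≥ : k + 3 ≤ p
  p≥ = ≮⇒≥ λ p< → 1+n≰n (begin
    suc (2 * k + 4)        ≡⟨ +-suc (2 * k) 4 ⟨
    2 * k + 5              ≤⟨ Tail.slow L B (trans ∣B∣≡z z≡3) {p} a ⟩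
    p + p                  ≤⟨ +-mono-≤ (s≤s⁻¹ (subst (suc p ≤_) (+-suc k 2) p<)) (s≤s⁻¹ (subst (suc p ≤_) (+-suc k 2) p<)) ⟩
    (k + 2) + (k + 2)      ≡⟨ eq k ⟩
    2 * k + 4              ∎)
    where
    open ≤-Reasoning
    eq : ∀ k → (k + 2) + (k + 2) ≡ 2 * k + 4
    eq = solve-∀
  q≤ : q ≤ 3
  q≤ = *-cancelˡ-≤ 2 (+-cancelʳ-≤ (3 + L) _ _ (subst (λ l → 2 * q + l ≤ 9 + L) l≡3+L (2pt+Z≤n+1 (complement (Gr (8 + L))) Q)))
  q≥ : 3 ≤ q
  q≥ = ≰⇒> λ q≤2 → coslow B̄ (trans ∣B̄∣≡l l≡3+L) (AllBlue-mono Ḡ B̄ {q} {2} q≤2 ā)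

theorem4p5 : ((n : ℕ) → 2 ≤ n → (G : Graph n) → (p q : ℕ) →
    IsPt G p → IsPt (complement G) q →
    (1 ≤ p + q) × (2 * (p + q) ≤ n + 4))
    ×
    ((n : ℕ) → 2 ≤ n →
    Σ (Graph n) (λ G → Σ ℕ (λ p → Σ ℕ (λ q →
    IsPt G p × IsPt (complement G) q × (p + q ≡ 1)))))
    ×
    ((m : ℕ) → 8 ≤ 2 * m →
    Σ (Graph (2 * m)) (λ G → Σ ℕ (λ p → Σ ℕ (λ q →
    IsPt G p × IsPt (complement G) q × (p + q ≡ m + 2)))))
theorem4p5 = bounds , lower-sharp , upper-sharp
  where
  bounds : (n : ℕ) → 2 ≤ n → (G : Graph n) → (p q : ℕ) →
    IsPt G p → IsPt (complement G) q → (1 ≤ p + q) × (2 * (p + q) ≤ n + 4)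
  bounds n 2≤n G p q P Q = pt-sum-lower 2≤n G P Q , pt-sum-upper G P Q

  Attained : ℕ → ℕ → Set
  Attained n s = Σ (Graph n) λ G → Σ ℕ λ p → Σ ℕ λ q → IsPt G p × IsPt (complement G) q × (p + q ≡ s)

  lower-sharp : (n : ℕ) → 2 ≤ n → Attained n 1
  lower-sharp n 2≤n = let (q , Q) = pt-exists (complement (edgeless n)) in
    edgeless n , 0 , q , pt-edgeless n , Q ,
    ≤-antisym (pt-complete≤1 Q) (pt-sum-lower 2≤n (edgeless n) (pt-edgeless n) Q)

  upper-sharp : (m : ℕ) → 8 ≤ 2 * m → Attained (2 * m) (m + 2)
  upper-sharp m 8≤2m = subst (λ m → Attained (2 * m) (m + 2)) (m+[n∸m]≡n (*-cancelˡ-≤ {4} {m} 2 8≤2m))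
    (subst (λ n → Attained n (4 + k + 2)) (sym (order-eq k))
      (let (p , P) = pt-exists (Gr (8 + 2 * k)); (q , Q) = pt-exists (complement (Gr (8 + 2 * k))) in
        Gr (8 + 2 * k) , p , q , P , Q , trans (family-pt-sum k P Q) (sum-eq k)))
    where
    k = m ∸ 4
    order-eq : ∀ k → 2 * (4 + k) ≡ 8 + 2 * k
    order-eq = solve-∀
    sum-eq : ∀ k → k + 6 ≡ 4 + k + 2
    sum-eq = solve-∀
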